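{- Let $x\ge 1$, $k\ge 1$, $n\ge 2$ and $y$ be integers with $T_k(x)=y^n$. Then the following hold. (i) If $x\equiv 0\pmod 4$, then $$n\le \begin{cases} v_2(x)-1, & \text{if } k=1 \text{ or } k \text{ is even},\\ 2v_2(x)-2, & \text{if } k\ge 3 \text{ is odd}.\end{cases}$$ (ii) If $x\equiv 1\pmod 4$ and $k=1$, then $n\le v_2(3x+1)-1$. If $x\equiv 1$ or $5\pmod 8$, $x\not\equiv 1\pmod{32}$ and $k\ne 1$, then $$n\le\begin{cases} v_2(7x+1)-1, & \text{if } x\equiv 1\pmod 8 \text{ and } k=2,\\ v_2((5x+3)(3x+1))-2, & \text{if } x\equiv 1\pmod 8 \text{ and } k=3,\\ v_2(3x+1), & \text{if } x\equiv 5\pmod 8 \text{ and } k\ge 3 \text{ is odd},\\ 1, & \text{if } x\equiv 5\pmod 8 \text{ and } k\ge 2 \text{ is even},\\ 2, & \text{if } x\equiv 9\pmod{16} \text{ and } k\ge 4 \text{ is even},\\ 3, & \text{if } x\equiv 9\pmod{16} \text{ and } k\ge 5 \text{ is odd, or if } x\equiv 17\pmod{32} \text{ and } k\ge 4 \text{ is even},\\ 4, & \text{if } x\equiv 17\pmod{32} \text{ and } k\ge 5 \text{ is odd}. \end{cases}$$ (iii) If either $x\equiv 0\pmod 3$ and $k$ is odd, or $x\equiv 0$ or $4\pmod 9$ and $k\ge 2$ is even, then $$n\le\begin{cases} v_3(x), & \text{if } x\equiv 0\pmod 3 \text{ and } k=1,\\ v_3(x)-1, & \text{if } x\equiv 0\pmod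 9 \text{ and } k\ge 2 \text{ is even},\\ v_3(kx^2), & \text{if } x\equiv 0\pmod 3 \text{ and } k>3 \text{ is odd},\\ v_3(x^2(5x+3)), & \text{if } x\equiv 0\pmod 3 \text{ and } k=3,\\ v_3(2x+1)-1, & \text{if } x\equiv 4\pmod 9 \text{ and } k\ge 2 \text{ is even}. \end{cases}$$
   Context: For positive integers $x,k$, $T_k(x)=(x+1)^k+(x+2)^k+\cdots+(2x)^k$. For a prime $p$ and a nonzero integer $m$, $v_p(m)$ denotes the largest exponent $v$ such that $p^v\mid m$. -}

module Defs where

open import Data.List.Base using (map; upTo)
open import Data.Nat.Base
open import Data.Nat.Divisibility using (_∣_; _∣?_; 1∣_; ∣⇒≤)
open import Data.Nat.ListAction using (sum)
open import Data.Nat.Properties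
open import Data.Product.Base using (_×_; _,_)
open import Data.Sum.Base using (inj₁; inj₂)
open import Relation.Binary.PropositionalEquality using (refl)
open import Relation.Nullary using (yes; no; contradiction)

-- upTo x lists 0, …, x ∸ 1, so the terms are (x + 1) ^ k, …, (x + x) ^ k.
T : ℕ → ℕ → ℕ
T k x = sum (map (λ i → (x + suc i) ^ k) (upTo x))

largestUpTo : ℕ → ℕ → ℕ → ℕ
largestUpTo zero    p m = 0
largestUpTo (suc b) p m with p ^ suc b ∣? m
... | yes _ = suc b
... | no  _ = largestUpTo b p m

-- Searching exponents up to m suffices, since j < p ^ j ≤ m whenever
-- p ^ j ∣ m; v-isLargest below makes this precise.
v : ℕ → ℕ → ℕ
v p m = largestUpTo m p m

private
  ^-largestUpTo-∣ : ∀ b p m → p ^ largestUpTo b p m ∣ m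
  ^-largestUpTo-∣ zero    p m = 1∣ m
  ^-largestUpTo-∣ (suc b) p m with p ^ suc b ∣? m
  ... | yes d = d
  ... | no  _ = ^-largestUpTo-∣ b p m

  largestUpTo-max : ∀ b p m j → j ≤ b → p ^ j ∣ m → j ≤ largestUpTo b p m
  largestUpTo-max zero    p m j j≤b d = j≤b
  largestUpTo-max (suc b) p m j j≤b d with p ^ suc b ∣? m
  ... | yes _ = j≤b
  ... | no ¬d with m≤n⇒m<n∨m≡n j≤b
  ...   | inj₁ (s≤s j≤b′) = largestUpTo-max b p m j j≤b′ d
  ...   | inj₂ refl       = contradiction d ¬d

  n<p^n : ∀ p .{{_ : NonTrivial p}} n → n < p ^ n
  n<p^n p zero    = s≤s z≤n
  n<p^n p (suc n) = ≤-<-trans (n<p^n p n) (^-monoʳ-< p (nonTrivial⇒n>1 p) (n<1+n n))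

v-isLargest : ∀ p m .{{_ : NonTrivial p}} .{{_ : NonZero m}} →
              p ^ v p m ∣ m × (∀ j → p ^ j ∣ m → j ≤ v p m)
v-isLargest p m =
  ^-largestUpTo-∣ m p m ,
  λ j d → largestUpTo-max m p m j (≤-trans (<⇒≤ (n<p^n p j)) (∣⇒≤ d)) d

{-# OPTIONS --safe #-}
module Submission where

-- If p divides y ^ n then n is at most the exponent of p in y ^ n, so it is
-- enough to determine the exponents of 2 and 3 in T k x. For even k, the k-th
-- powers of p ^ (c + 1) m consecutive integers add up to (p - 1) m p ^ c modulo
-- p ^ (c + 1) (p = 2, 3). For odd k, reflecting the range by u ↦ s - u with
-- s = 3x or s = 3x + 1 and expanding (s - u) ^ k to first order in s gives
-- 2 T k x ≡ k s T (k - 1) x up to end terms, which reduces to an even exponent.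
-- The exponents 1, 2 and 3 are read off the closed forms of T.

-- The exponent of `p` in `T k x` has to be positive, since otherwise `p` does not divide `y` and
-- nothing bounds `n`. For even `k` a range of length `p ^ (c + 1) m` yields only `p ^ c`, so the
-- length must contain `p` twice: hence 4 or 9 dividing `x`, and 9 dividing `2x + 1` when x ≡ 4 mod
-- 9. For odd `k` the difficulty is to keep the error of the expansion in `s` below the main term
-- `k s T (k - 1) x`. For p = 2, halving costs one factor of the modulus. For p = 3, a power `3 ^ b`
-- in `k` raises the main term, so the error must be shown to be a multiple of `3 ^ b s ^ 2` and not
-- just of `s ^ 2`. For x ≡ 1 mod 8, `s = 3x + 1` contains 2 exactly twice, the error `s ^ 2` is too
-- coarse, and the expansion goes to second order. Small `k` escape these estimates because the end
-- terms are then not divisible enough, or because the second-order term involves exponent 1; this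
-- is why closed forms are used there.

module PowerSums where

  open import Data.Integer.Base using (ℤ; +_; -_; _+_; _-_; _*_; _^_; 0ℤ; 1ℤ; ∣_∣)
  import Data.Integer.Divisibility.Signed as ℤ∣
  open import Data.Integer.Properties using (+-identityˡ; +-identityʳ; +-comm; +-assoc; +-injective; *-zeroˡ; *-zeroʳ; *-identityˡ; *-comm; *-assoc; *-distribˡ-+; *-cancelˡ-≡; ^-zeroˡ; ^-distribˡ-+-*; ^-*-assoc; pos-*; abs-*)
  open import Data.Integer.Tactic.RingSolver using (solve-∀)
  open import Data.List.Base using (applyUpTo)
  open import Data.List.Properties using (map-upTo)
  open import Data.Nat.Base as ℕ using (ℕ; zero; suc; _≤_; s≤s)
  open import Data.Nat.Divisibility using (_∣_; _∤_; divides; divides-refl; ∣-refl; ∣-trans; ∣1⇒≡1; m∣m*n; *-pres-∣)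
  open import Data.Nat.ListAction using (sum)
  open import Data.Nat.Primality using (Prime; prime?; euclidsLemma; prime⇒nonZero; prime⇒nonTrivial)
  import Data.Nat.Properties as ℕ
  import Data.Nat.Tactic.RingSolver as ℕR
  open import Data.Product.Base using (∃; ∃₂; _×_; _,_; proj₁; proj₂)
  open import Data.Sum.Base using (inj₁; inj₂; [_,_]′)
  open import Defs
  open import Relation.Binary.PropositionalEquality
  open import Relation.Nullary using (contradiction)
  open import Relation.Nullary.Decidable using (from-yes)

  -- Congruences between integers

  -- The quotient is data: matching the equality with `refl` replaces `a` by `b + m * quotient`, and
  -- a congruence becomes a polynomial identity for the ring solver.
  infix 4 _≈_[mod_]
  record _≈_[mod_] (a b m : ℤ) : Set where
    constructor quot
    field
      quotient : ℤ
      equality : a ≡ b + m * quotient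

  open _≈_[mod_]

  mod-refl : ∀ {m a b} → a ≡ b → a ≈ b [mod m ]
  mod-refl {m} {b = b} refl = quot 0ℤ (alg m b)
    where alg : ∀ m b → b ≡ b + m * 0ℤ
          alg = solve-∀

  mod-trans : ∀ {m a b c} → a ≈ b [mod m ] → b ≈ c [mod m ] → a ≈ c [mod m ]
  mod-trans {m} {c = c} (quot p refl) (quot q refl) = quot (q + p) (alg m c p q)
    where alg : ∀ m c p q → c + m * q + m * p ≡ c + m * (q + p)
          alg = solve-∀

  mod-+ : ∀ {m a b c d} → a ≈ b [mod m ] → c ≈ d [mod m ] → a + c ≈ b + d [mod m ]
  mod-+ {m} {b = b} {d = d} (quot p refl) (quot q refl) = quot (p + q) (alg m b d p q)
    where alg : ∀ m b d p q → b + m * p + (d + m * q) ≡ b + d + m * (p + q)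
          alg = solve-∀

  mod-* : ∀ {m a b c d} → a ≈ b [mod m ] → c ≈ d [mod m ] → a * c ≈ b * d [mod m ]
  mod-* {m} {b = b} {d = d} (quot p refl) (quot q refl) =
    quot (p * d + b * q + m * p * q) (alg m b d p q)
    where alg : ∀ m b d p q → (b + m * p) * (d + m * q) ≡ b * d + m * (p * d + b * q + m * p * q)
          alg = solve-∀

  mod-^ : ∀ {m a b} k → a ≈ b [mod m ] → a ^ k ≈ b ^ k [mod m ]
  mod-^ zero    a≈b = mod-refl refl
  mod-^ (suc k) a≈b = mod-* a≈b (mod-^ k a≈b)

  mod-weaken : ∀ {m a b} l → a ≈ b [mod m * l ] → a ≈ b [mod m ]
  mod-weaken {m} {b = b} l (quot q refl) = quot (l * q) (cong (_+_ b) (*-assoc m l q))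

  -- Sums over consecutive integers

  Sum : (ℤ → ℤ) → ℤ → ℕ → ℤ
  Sum f a zero    = 0ℤ
  Sum f a (suc n) = f a + Sum f (1ℤ + a) n

  Sum-++ : ∀ f a m n → Sum f a (m ℕ.+ n) ≡ Sum f a m + Sum f (+ m + a) n
  Sum-++ f a zero    n = trans (cong (λ b → Sum f b n) (sym (+-identityˡ a))) (sym (+-identityˡ _))
  Sum-++ f a (suc m) n = begin
    f a + Sum f (1ℤ + a) (m ℕ.+ n)
      ≡⟨ cong (_+_ (f a)) (Sum-++ f (1ℤ + a) m n) ⟩
    f a + (Sum f (1ℤ + a) m + Sum f (+ m + (1ℤ + a)) n)
      ≡⟨ cong (λ b → f a + (Sum f (1ℤ + a) m + Sum f b n)) (alg (+ m) a) ⟩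
    f a + (Sum f (1ℤ + a) m + Sum f (1ℤ + + m + a) n)
      ≡⟨ +-assoc (f a) _ _ ⟨
    f a + Sum f (1ℤ + a) m + Sum f (1ℤ + + m + a) n ∎
    where
    open ≡-Reasoning
    alg : ∀ m a → m + (1ℤ + a) ≡ 1ℤ + m + a
    alg = solve-∀

  Sum-snoc : ∀ f a n → Sum f a (suc n) ≡ Sum f a n + f (+ n + a)
  Sum-snoc f a n = begin
    Sum f a (suc n)                ≡⟨ cong (Sum f a) (ℕ.+-comm 1 n) ⟩
    Sum f a (n ℕ.+ 1)              ≡⟨ Sum-++ f a n 1 ⟩
    Sum f a n + (f (+ n + a) + 0ℤ) ≡⟨ cong (_+_ (Sum f a n)) (+-identityʳ _) ⟩
    Sum f a n + f (+ n + a)        ∎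
    where open ≡-Reasoning

  Sum-+ : ∀ f g a n → Sum (λ u → f u + g u) a n ≡ Sum f a n + Sum g a n
  Sum-+ f g a zero    = refl
  Sum-+ f g a (suc n) =
    trans (cong (_+_ (f a + g a)) (Sum-+ f g (1ℤ + a) n)) (alg (f a) (g a) _ _)
    where alg : ∀ p q r s → p + q + (r + s) ≡ p + r + (q + s)
          alg = solve-∀

  Sum-* : ∀ c f a n → Sum (λ u → c * f u) a n ≡ c * Sum f a n
  Sum-* c f a zero    = sym (*-zeroʳ c)
  Sum-* c f a (suc n) =
    trans (cong (_+_ (c * f a)) (Sum-* c f (1ℤ + a) n)) (sym (*-distribˡ-+ c (f a) _))

  Sum-linear : ∀ c d f g a n → Sum (λ u → c * f u + d * g u) a n ≡ c * Sum f a n + d * Sum g a n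
  Sum-linear c d f g a n =
    trans (Sum-+ (λ u → c * f u) (λ u → d * g u) a n) (cong₂ _+_ (Sum-* c f a n) (Sum-* d g a n))

  Sum-mod : ∀ {m f g} → (∀ u → f u ≈ g u [mod m ]) → ∀ a n → Sum f a n ≈ Sum g a n [mod m ]
  Sum-mod f≈g a zero    = mod-refl refl
  Sum-mod f≈g a (suc n) = mod-+ (f≈g a) (Sum-mod f≈g (1ℤ + a) n)

  Sum-shift : ∀ f s a n → Sum f (s + a) n ≡ Sum (λ u → f (s + u)) a n
  Sum-shift f s a zero    = refl
  Sum-shift f s a (suc n) =
    cong (_+_ (f (s + a)))
      (trans (cong (λ b → Sum f b n) (alg s a)) (Sum-shift f s (1ℤ + a) n))
    where alg : ∀ s a → 1ℤ + (s + a) ≡ s + (1ℤ + a)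
          alg = solve-∀

  -- The map `u ↦ s - u` exchanges the two ranges when the first element of one and the last of the
  -- other, `a` and `b + n - 1`, add up to `s`. The induction removes the first term on one side and
  -- the last on the other.
  Sum-reflect : ∀ f s a b n → 1ℤ + s ≡ a + b + + n → Sum f a n ≡ Sum (λ u → f (s - u)) b n
  Sum-reflect f s a b zero    eq = refl
  Sum-reflect f s a b (suc n) eq = begin
    f a + Sum f (1ℤ + a) n
      ≡⟨ cong (_+_ (f a)) (Sum-reflect f s (1ℤ + a) b n (trans eq (alg₁ a b (+ n)))) ⟩
    f a + Sum (λ u → f (s - u)) b n
      ≡⟨ +-comm (f a) _ ⟩
    Sum (λ u → f (s - u)) b n + f a
      ≡⟨ cong (λ c → Sum (λ u → f (s - u)) b n + f c) a≡ ⟩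
    Sum (λ u → f (s - u)) b n + f (s - (+ n + b))
      ≡⟨ Sum-snoc (λ u → f (s - u)) b n ⟨
    Sum (λ u → f (s - u)) b (suc n) ∎
    where
    open ≡-Reasoning
    alg₁ : ∀ a b n → a + b + (1ℤ + n) ≡ 1ℤ + a + b + n
    alg₁ = solve-∀
    alg₂ : ∀ a b n → a ≡ a + b + (1ℤ + n) - 1ℤ - (n + b)
    alg₂ = solve-∀
    alg₃ : ∀ s t → 1ℤ + s - 1ℤ - t ≡ s - t
    alg₃ = solve-∀
    a≡ : a ≡ s - (+ n + b)
    a≡ = trans (alg₂ a b (+ n))
           (trans (cong (λ c → c - 1ℤ - (+ n + b)) (sym eq)) (alg₃ s (+ n + b)))

  P : ℕ → ℤ → ℕ → ℤ
  P k = Sum (_^ k)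

  -- Expansions of a power of a sum

  expand₁ : ∀ k s w → (s + w) ^ suc k ≈ w ^ suc k + + suc k * s * w ^ k [mod s * s ]
  expand₁ zero    s w = quot 0ℤ (alg s w)
    where alg : ∀ s w → (s + w) * 1ℤ ≡ w * 1ℤ + 1ℤ * s * 1ℤ + s * s * 0ℤ
          alg = solve-∀
  expand₁ (suc k) s w with expand₁ k s w
  ... | quot q eq = quot (K * W + s * q + w * q) (trans (cong ((s + w) *_) eq) (alg s w K W q))
    where
    K = + suc k
    W = w ^ k
    alg : ∀ s w K W q → (s + w) * (w * W + K * s * W + s * s * q)
        ≡ w * (w * W) + (1ℤ + K) * s * (w * W) + s * s * (K * W + s * q + w * q)
    alg = solve-∀

  expand₂ : ∀ k s → ∃ λ b → ∀ w →
    (s + w) ^ (2 ℕ.+ k) ≈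
    w ^ (2 ℕ.+ k) + + (2 ℕ.+ k) * s * w ^ (1 ℕ.+ k) + b * s * s * w ^ k [mod s * s * s ]
  expand₂ zero    s = 1ℤ , λ w → quot 0ℤ (alg s w)
    where alg : ∀ s w → (s + w) * ((s + w) * 1ℤ)
              ≡ w * (w * 1ℤ) + + 2 * s * (w * 1ℤ) + 1ℤ * s * s * 1ℤ + s * s * s * 0ℤ
          alg = solve-∀
  expand₂ (suc k) s with expand₂ k s
  ... | b , ih = K + b , λ w → quot
    (b * w ^ k + s * quotient (ih w) + w * quotient (ih w))
    (trans (cong ((s + w) *_) (equality (ih w))) (alg s w K b (w ^ k) (quotient (ih w))))
    where
    K = + (2 ℕ.+ k)
    alg : ∀ s w K b W q →
      (s + w) * (w * (w * W) + K * s * (w * W) + b * s * s * W + s * s * s * q)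
        ≡ w * (w * (w * W)) + (1ℤ + K) * s * (w * (w * W)) + (K + b) * s * s * (w * W)
          + s * s * s * (b * W + s * q + w * q)
    alg = solve-∀

  pos-^ : ∀ p c → + (p ℕ.^ c) ≡ (+ p) ^ c
  pos-^ p zero    = refl
  pos-^ p (suc c) = trans (pos-* p (p ℕ.^ c)) (cong ((+ p) *_) (pos-^ p c))

  -- The refinement of `expand₁` for exponents divisible by `3 ^ b`. The `b`-fold cubing gains a
  -- factor 3 in the error each time, matching the factor `3 ^ b` in the first-order term.
  expand-3^ : ∀ b c j r w → suc j ≡ 3 ℕ.^ b ℕ.* c →
    let s = + 3 * r in
    (s + w) ^ suc j ≈ w ^ suc j + + suc j * s * w ^ j [mod (+ 3) ^ b * (s * s) ]
  expand-3^ zero    c j r w eq with expand₁ j (+ 3 * r) w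
  ... | quot q e = quot q (trans e
    (cong (λ m → w ^ suc j + + suc j * (+ 3 * r) * w ^ j + m * q) (sym (*-identityˡ (+ 3 * r * (+ 3 * r))))))
  expand-3^ (suc b) c j r w eq with 3 ℕ.^ b ℕ.* c in 3^b*c≡
  ... | zero  = contradiction (trans eq (trans (ℕ.*-assoc 3 (3 ℕ.^ b) c) (cong (3 ℕ.*_) 3^b*c≡))) λ ()
  ... | suc i with refl ← ℕ.suc-injective (trans eq (trans (ℕ.*-assoc 3 (3 ℕ.^ b) c)
                            (trans (cong (3 ℕ.*_) 3^b*c≡) (ℕ.*-comm 3 (suc i)))))
              with quot q e ← expand-3^ b c i r w (sym 3^b*c≡) = quot
    -- The cube of `w * W + B * s * E`, divided by `3 * B * (s * s)` after the two leading terms.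
    -- The mixed terms carry the binomial factor 3; the pure cube of `B * s * E` does not, and takes
    -- its 3 from `s = 3 * r`.
    (w * w * W * W * q + w * W * B * E * E + B * B * r * E * E * E)
    (begin
      (s + w) ^ (suc i ℕ.* 3)
        ≡⟨ ^-*-assoc (s + w) (suc i) 3 ⟨
      ((s + w) ^ suc i) ^ 3
        ≡⟨ cong (_^ 3) (trans e (cong (λ K → w * W + K * s * W + B * (s * s) * q) K≡)) ⟩
      (w * W + B * C * s * W + B * (s * s) * q) ^ 3
        ≡⟨ alg w W B C r q ⟩
      w * (w * (w * (W ^ 3))) + B * C * + 3 * s * (w * (w * (W ^ 3))) + + 3 * B * (s * s) * Q
        ≡⟨ cong₂ (λ V K → w * (w * (w * V)) + K * s * (w * (w * V)) + + 3 * B * (s * s) * Q)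
             (^-*-assoc w i 3) (sym (trans (pos-* (suc i) 3) (cong (_* + 3) K≡))) ⟩
      w ^ (suc i ℕ.* 3) + + (suc i ℕ.* 3) * s * w ^ (2 ℕ.+ i ℕ.* 3) + + 3 * B * (s * s) * Q ∎)
    where
    open ≡-Reasoning
    s = + 3 * r
    B = (+ 3) ^ b
    C = + c
    W = w ^ i
    E = C * W + s * q
    Q = w * w * W * W * q + w * W * B * E * E + B * B * r * E * E * E
    K≡ : + suc i ≡ B * C
    K≡ = trans (cong +_ (sym 3^b*c≡)) (trans (pos-* (3 ℕ.^ b) c) (cong (_* C) (pos-^ 3 b)))
    alg : ∀ w W B C r q →
      let s = + 3 * r
          E = C * W + s * q
          D = w * W + B * C * s * W + B * (s * s) * q
          V = W * (W * (W * 1ℤ))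
      in D * (D * (D * 1ℤ))
         ≡ w * (w * (w * V)) + B * C * + 3 * s * (w * (w * V))
           + + 3 * B * (s * s) * (w * w * W * W * q + w * W * B * E * E + B * B * r * E * E * E)
    alg = solve-∀

  -- Sums over full periods

  -- Moving the start from `a` to `1 + a` trades the term at `a` for the one at `N + a`, which has
  -- the same residue.
  P-period₁ : ∀ k a N → P k (+ a) N ≈ P k 0ℤ N [mod + N ]
  P-period₁ k zero    N = mod-refl refl
  P-period₁ k (suc a) N = mod-trans step (P-period₁ k a N)
    where
    alg₁ : ∀ p q → q ≡ p + q - p
    alg₁ = solve-∀
    alg₂ : ∀ r n p q → r + (p + n * q) - p ≡ r + n * q
    alg₂ = solve-∀
    alg₃ : ∀ n a → n + a ≡ a + n * 1ℤ
    alg₃ = solve-∀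
    N+a : (+ N + + a) ^ k ≈ (+ a) ^ k [mod + N ]
    N+a = mod-^ k (quot 1ℤ (alg₃ (+ N) (+ a)))
    step : P k (+ suc a) N ≈ P k (+ a) N [mod + N ]
    step = quot (quotient N+a) (trans (alg₁ ((+ a) ^ k) _)
      (trans (cong (_- (+ a) ^ k) (trans (Sum-snoc (_^ k) (+ a) N) (cong (_+_ (P k (+ a) N)) (equality N+a))))
        (alg₂ (P k (+ a) N) (+ N) ((+ a) ^ k) _)))

  P-period : ∀ k a m N → P k (+ a) (m ℕ.* N) ≈ + m * P k 0ℤ N [mod + N ]
  P-period k a zero    N = mod-refl refl
  P-period k a (suc m) N = mod-trans (mod-refl (Sum-++ (_^ k) (+ a) N (m ℕ.* N)))
    (mod-trans (mod-+ (P-period₁ k a N) (P-period k (N ℕ.+ a) m N))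
      (mod-refl (alg (P k 0ℤ N) (+ m))))
    where alg : ∀ p m → p + m * p ≡ (1ℤ + m) * p
          alg = solve-∀

  -- Squaring gains a factor 2 over the shift `2 * M`. This is what lets the two halves of a range
  -- of length `2 ^ (c + 2)` agree modulo the full length, and so drives the doubling in
  -- `even-P-2^`.
  even-power-shift-2 : ∀ k M u → (+ 2 * M + u) ^ (2 ℕ.* k) ≈ u ^ (2 ℕ.* k) [mod + 2 * (+ 2 * M) ]
  even-power-shift-2 k M u =
    subst₂ (_≈_[mod + 2 * (+ 2 * M) ]) (^-*-assoc (+ 2 * M + u) 2 k) (^-*-assoc u 2 k)
      (mod-^ k (quot (M + u) (alg M u)))
    where alg : ∀ M u → (+ 2 * M + u) * ((+ 2 * M + u) * 1ℤ) ≡ u * (u * 1ℤ) + + 2 * (+ 2 * M) * (M + u)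
          alg = solve-∀

  even-P-2^ : ∀ h c → P (2 ℕ.* suc h) 0ℤ (2 ℕ.^ suc c) ≈ (+ 2) ^ c [mod (+ 2) ^ suc c ]
  even-P-2^ h zero    = mod-refl (trans (+-identityˡ _) (trans (+-identityʳ _) (^-zeroˡ (2 ℕ.* suc h))))
  even-P-2^ h (suc c) = quot (q + q′) (begin
    P k 0ℤ (2 ℕ.* N)
      ≡⟨ cong (P k 0ℤ) (cong (N ℕ.+_) (ℕ.+-identityʳ N)) ⟩
    P k 0ℤ (N ℕ.+ N)
      ≡⟨ Sum-++ (_^ k) 0ℤ N N ⟩
    P k 0ℤ N + P k (+ N + 0ℤ) N
      ≡⟨ cong (_+_ (P k 0ℤ N)) (trans (cong (λ s → P k (s + 0ℤ) N) (pos-^ 2 (suc c)))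
           (trans (Sum-shift (_^ k) (+ 2 * M) 0ℤ N) e′)) ⟩
    P k 0ℤ N + (P k 0ℤ N + + 2 * (+ 2 * M) * q′)
      ≡⟨ cong (λ p → p + (p + + 2 * (+ 2 * M) * q′)) e ⟩
    M + + 2 * M * q + (M + + 2 * M * q + + 2 * (+ 2 * M) * q′)
      ≡⟨ alg M q q′ ⟩
    + 2 * M + + 2 * (+ 2 * M) * (q + q′) ∎)
    where
    open ≡-Reasoning
    k = 2 ℕ.* suc h
    N = 2 ℕ.^ suc c
    M = (+ 2) ^ c
    open _≈_[mod_] (even-P-2^ h c) renaming (quotient to q; equality to e)
    open _≈_[mod_] (Sum-mod (even-power-shift-2 (suc h) M) 0ℤ N) renaming (quotient to q′; equality to e′)
    alg : ∀ M q q′ → M + + 2 * M * q + (M + + 2 * M * q + + 2 * (+ 2 * M) * q′)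
                   ≡ + 2 * M + + 2 * (+ 2 * M) * (q + q′)
    alg = solve-∀

  -- The first-order terms for the shifts `N` and `2 * N` add up to a multiple of `3 * N`, and
  -- `N * N` is one because 3 divides `N`.
  power-shift-3 : ∀ k M u →
    let N = + 3 * M in
    (N + u) ^ suc k + (+ 2 * N + u) ^ suc k ≈ + 2 * u ^ suc k [mod + 3 * N ]
  power-shift-3 k M u with quot q e ← expand₁ k (+ 3 * M) u
                      with quot q′ e′ ← expand₁ k (+ 2 * (+ 3 * M)) u
    = quot (+ suc k * u ^ k + M * (q + + 4 * q′))
           (trans (cong₂ _+_ e e′) (alg (+ suc k) (u ^ suc k) (u ^ k) M q q′))
    where
    alg : ∀ K U V M q q′ →
      let N = + 3 * M in
      U + K * N * V + N * N * q + (U + K * (+ 2 * N) * V + + 2 * N * (+ 2 * N) * q′)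
        ≡ + 2 * U + + 3 * N * (K * V + M * (q + + 4 * q′))
    alg = solve-∀

  even-P-3^ : ∀ h c → P (2 ℕ.* suc h) 0ℤ (3 ℕ.^ suc c) ≈ + 2 * (+ 3) ^ c [mod (+ 3) ^ suc c ]
  even-P-3^ h zero    = mod-trans
    (mod-refl (trans (+-identityˡ _)
      (cong₂ (λ p q → p + (q + 0ℤ)) (^-zeroˡ (2 ℕ.* suc h)) (sym (^-*-assoc (+ 2) 2 (suc h))))))
    -- The range 0, 1, 2 gives `1 + 4 ^ suc h`, and 4 ≡ 1 mod 3. The evenness of the exponent enters
    -- here; the tripling step holds for any positive exponent.
    (mod-+ (mod-refl {b = 1ℤ} refl)
      (mod-+ (mod-trans (mod-^ (suc h) (quot {b = 1ℤ} 1ℤ refl)) (mod-refl (^-zeroˡ (suc h)))) (mod-refl {b = 0ℤ} refl)))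
  even-P-3^ h (suc c) = quot (q + q′) (begin
    P k 0ℤ (3 ℕ.* N)
      ≡⟨ cong (λ n → P k 0ℤ (N ℕ.+ (N ℕ.+ n))) (ℕ.+-identityʳ N) ⟩
    P k 0ℤ (N ℕ.+ (N ℕ.+ N))
      ≡⟨ Sum-++ (_^ k) 0ℤ N (N ℕ.+ N) ⟩
    P k 0ℤ N + P k (+ N + 0ℤ) (N ℕ.+ N)
      ≡⟨ cong (_+_ (P k 0ℤ N)) (Sum-++ (_^ k) (+ N + 0ℤ) N N) ⟩
    P k 0ℤ N + (P k (+ N + 0ℤ) N + P k (+ N + (+ N + 0ℤ)) N)
      ≡⟨ cong (λ s → P k 0ℤ N + (P k (s + 0ℤ) N + P k (s + (s + 0ℤ)) N)) (pos-^ 3 (suc c)) ⟩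
    P k 0ℤ N + (P k (L + 0ℤ) N + P k (L + (L + 0ℤ)) N)
      ≡⟨ cong (λ s → P k 0ℤ N + (P k (L + 0ℤ) N + P k s N)) (alg₁ L) ⟩
    P k 0ℤ N + (P k (L + 0ℤ) N + P k (+ 2 * L + 0ℤ) N)
      ≡⟨ cong (_+_ (P k 0ℤ N)) (cong₂ _+_ (Sum-shift (_^ k) L 0ℤ N) (Sum-shift (_^ k) (+ 2 * L) 0ℤ N)) ⟩
    P k 0ℤ N + (Sum (λ u → (L + u) ^ k) 0ℤ N + Sum (λ u → (+ 2 * L + u) ^ k) 0ℤ N)
      ≡⟨ cong (_+_ (P k 0ℤ N)) (trans (sym (Sum-+ _ _ 0ℤ N))
           (trans e′ (cong (_+ + 3 * L * q′) (Sum-* (+ 2) (_^ k) 0ℤ N)))) ⟩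
    P k 0ℤ N + (+ 2 * P k 0ℤ N + + 3 * L * q′)
      ≡⟨ cong (λ p → p + (+ 2 * p + + 3 * L * q′)) e ⟩
    + 2 * M + + 3 * M * q + (+ 2 * (+ 2 * M + + 3 * M * q) + + 3 * (+ 3 * M) * q′)
      ≡⟨ alg M q q′ ⟩
    + 2 * (+ 3 * M) + + 3 * (+ 3 * M) * (q + q′) ∎)
    where
    open ≡-Reasoning
    k = 2 ℕ.* suc h
    N = 3 ℕ.^ suc c
    M = (+ 3) ^ c
    L = + 3 * M
    open _≈_[mod_] (even-P-3^ h c) renaming (quotient to q; equality to e)
    open _≈_[mod_] (Sum-mod (power-shift-3 (ℕ.pred k) M) 0ℤ N) renaming (quotient to q′; equality to e′)
    alg₁ : ∀ L → L + (L + 0ℤ) ≡ + 2 * L + 0ℤ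
    alg₁ = solve-∀
    alg : ∀ M q q′ → + 2 * M + + 3 * M * q + (+ 2 * (+ 2 * M + + 3 * M * q) + + 3 * (+ 3 * M) * q′)
                   ≡ + 2 * (+ 3 * M) + + 3 * (+ 3 * M) * (q + q′)
    alg = solve-∀

  even-P-multiple-2^ : ∀ h a m c →
    P (2 ℕ.* suc h) (+ a) (m ℕ.* 2 ℕ.^ suc c) ≈ + m * (+ 2) ^ c [mod (+ 2) ^ suc c ]
  even-P-multiple-2^ h a m c = mod-trans
    (subst (P (2 ℕ.* suc h) (+ a) (m ℕ.* 2 ℕ.^ suc c) ≈ + m * P (2 ℕ.* suc h) 0ℤ (2 ℕ.^ suc c) [mod_])
      (pos-^ 2 (suc c)) (P-period (2 ℕ.* suc h) a m (2 ℕ.^ suc c)))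
    (mod-* (mod-refl {b = + m} refl) (even-P-2^ h c))

  even-P-multiple-3^ : ∀ h a m c →
    P (2 ℕ.* suc h) (+ a) (m ℕ.* 3 ℕ.^ suc c) ≈ + (2 ℕ.* m) * (+ 3) ^ c [mod (+ 3) ^ suc c ]
  even-P-multiple-3^ h a m c = mod-trans
    (subst (P (2 ℕ.* suc h) (+ a) (m ℕ.* 3 ℕ.^ suc c) ≈ + m * P (2 ℕ.* suc h) 0ℤ (3 ℕ.^ suc c) [mod_])
      (pos-^ 3 (suc c)) (P-period (2 ℕ.* suc h) a m (3 ℕ.^ suc c)))
    (mod-trans (mod-* (mod-refl {b = + m} refl) (even-P-3^ h c))
      (mod-refl (trans (alg (+ m) ((+ 3) ^ c)) (cong (_* (+ 3) ^ c) (sym (pos-* 2 m))))))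
    where alg : ∀ m E → m * (+ 2 * E) ≡ + 2 * m * E
          alg = solve-∀

  -- Reflection

  P-reflect : ∀ {M} k g s a b n → 1ℤ + s ≡ a + b + + n →
    (∀ u → (s - u) ^ k + u ^ k ≈ g u [mod M ]) →
    P k a n + P k b n ≈ Sum g b n [mod M ]
  P-reflect k g s a b n eq h = mod-trans
    (mod-refl (trans (cong (_+ P k b n) (Sum-reflect (_^ k) s a b n eq))
                     (sym (Sum-+ (λ u → (s - u) ^ k) (_^ k) b n))))
    (Sum-mod h b n)

  neg-even-power : ∀ h u → (- u) ^ (2 ℕ.* h) ≡ u ^ (2 ℕ.* h)
  neg-even-power h u = trans (sym (^-*-assoc (- u) 2 h)) (trans (cong (_^ h) (alg u)) (^-*-assoc u 2 h))
    where alg : ∀ u → - u * (- u * 1ℤ) ≡ u * (u * 1ℤ)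
          alg = solve-∀

  -- At `w = - u` the leading odd power changes sign and cancels against `u ^ k`, while the even
  -- power in the first-order term is unchanged. The expansion is a hypothesis because it is needed
  -- both modulo `s * s` and modulo `3 ^ b * (s * s)`.
  odd-P-reflect : ∀ {M} h s a b n → 1ℤ + s ≡ a + b + + n → let k = suc (2 ℕ.* h) in
    (∀ w → (s + w) ^ k ≈ w ^ k + + k * s * w ^ (2 ℕ.* h) [mod M ]) →
    P k a n + P k b n ≈ + k * s * P (2 ℕ.* h) b n [mod M ]
  odd-P-reflect {M} h s a b n eq expand = mod-trans (P-reflect k g s a b n eq pair) (mod-refl (Sum-* (+ k * s) (_^ (2 ℕ.* h)) b n))
    where
    k = suc (2 ℕ.* h)
    g = λ u → + k * s * u ^ (2 ℕ.* h)
    alg : ∀ u U C → - u * U + C * U + u * U ≡ C * U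
    alg = solve-∀
    pair : ∀ u → (s - u) ^ k + u ^ k ≈ g u [mod M ]
    pair u = mod-trans (mod-+ (expand (- u)) (mod-refl refl)) (mod-refl
      (trans (cong (λ U → - u * U + + k * s * U + u ^ k) (neg-even-power h u)) (alg u (u ^ (2 ℕ.* h)) (+ k * s))))

  -- The second-order term carries the odd power of exponent `k - 2`, so it changes sign at
  -- `w = - u`; hence the witness `- B`.
  odd-P-reflect₂ : ∀ h s a b n → 1ℤ + s ≡ a + b + + n → let k = 3 ℕ.+ 2 ℕ.* h in
    ∃ λ B → P k a n + P k b n
      ≈ + k * s * P (2 ℕ.+ 2 ℕ.* h) b n + B * (s * s) * P (1 ℕ.+ 2 ℕ.* h) b n [mod s * s * s ]
  odd-P-reflect₂ h s a b n eq = - B , mod-trans (P-reflect k g s a b n eq pair)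
    (mod-refl (Sum-linear C D (_^ (2 ℕ.+ 2 ℕ.* h)) (_^ (1 ℕ.+ 2 ℕ.* h)) b n))
    where
    k = 3 ℕ.+ 2 ℕ.* h
    B = proj₁ (expand₂ (1 ℕ.+ 2 ℕ.* h) s)
    expand = proj₂ (expand₂ (1 ℕ.+ 2 ℕ.* h) s)
    C = + k * s
    D = - B * (s * s)
    g = λ u → C * u ^ (2 ℕ.+ 2 ℕ.* h) + D * u ^ (1 ℕ.+ 2 ℕ.* h)
    alg : ∀ u U C B s →
      - u * (- u * (- u * U)) + C * (- u * (- u * U)) + B * s * s * (- u * U) + u * (u * (u * U))
        ≡ C * (u * (u * U)) + - B * (s * s) * (u * U)
    alg = solve-∀
    pair : ∀ u → (s - u) ^ k + u ^ k ≈ g u [mod s * s * s ]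
    pair u = mod-trans (mod-+ (expand (- u)) (mod-refl {b = u ^ k} refl)) (mod-refl
      (trans (cong (λ U → - u * (- u * (- u * U)) + C * (- u * (- u * U)) + B * s * s * (- u * U) + u ^ k)
                   (neg-even-power h u))
        (alg u (u ^ (2 ℕ.* h)) C B s)))

  sum-applyUpTo : ∀ k a n (f : ℕ → ℕ) → (∀ i → + f i ≡ (+ i + a) ^ k) →
    + sum (applyUpTo f n) ≡ P k a n
  sum-applyUpTo k a zero    f eq = refl
  sum-applyUpTo k a (suc n) f eq = cong₂ _+_ (trans (eq 0) (cong (_^ k) (+-identityˡ a)))
    (sum-applyUpTo k (1ℤ + a) n (λ i → f (suc i))
      (λ i → trans (eq (suc i)) (cong (_^ k) (alg (+ i) a))))
    where alg : ∀ i a → 1ℤ + i + a ≡ i + (1ℤ + a)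
          alg = solve-∀

  T≡P : ∀ k x → + T k x ≡ P k (+ suc x) x
  T≡P k x = trans (cong (λ l → + sum l) (map-upTo (λ i → (x ℕ.+ suc i) ℕ.^ k) x))
    (sum-applyUpTo k (+ suc x) x _ λ i → trans (pos-^ (x ℕ.+ suc i) k)
      (cong (λ u → (+ u) ^ k) (alg x i)))
    where alg : ∀ x i → x ℕ.+ suc i ≡ i ℕ.+ suc x
          alg x i = trans (ℕ.+-suc x i) (trans (cong suc (ℕ.+-comm x i)) (sym (ℕ.+-suc i x)))

  -- Valuations

  prime[3] : Prime 3
  prime[3] = from-yes (prime? 3)

  ^-monoˡ-∣ : ∀ n {m o} → m ∣ o → m ℕ.^ n ∣ o ℕ.^ n
  ^-monoˡ-∣ zero    m∣o = ∣-refl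
  ^-monoˡ-∣ (suc n) m∣o = *-pres-∣ m∣o (^-monoˡ-∣ n m∣o)

  ^-monoʳ-∣ : ∀ m {i j} → i ≤ j → m ℕ.^ i ∣ m ℕ.^ j
  ^-monoʳ-∣ m {i} {j} i≤j = subst (λ e → m ℕ.^ i ∣ m ℕ.^ e) (ℕ.m+[n∸m]≡n i≤j)
    (subst (m ℕ.^ i ∣_) (sym (ℕ.^-distribˡ-+-* m i (j ℕ.∸ i))) (m∣m*n _))

  prime∣^⇒prime∣ : ∀ {p} → Prime p → ∀ m n → p ∣ m ℕ.^ n → p ∣ m
  prime∣^⇒prime∣ pr m zero    p∣1 = contradiction (ℕ.nonTrivial⇒≢1 {{prime⇒nonTrivial pr}}) λ p≢1 → p≢1 (∣1⇒≡1 p∣1)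
  prime∣^⇒prime∣ pr m (suc n) p∣m^ with euclidsLemma m (m ℕ.^ n) pr p∣m^
  ... | inj₁ p∣m  = p∣m
  ... | inj₂ p∣m^ = prime∣^⇒prime∣ pr m n p∣m^

  prime∤* : ∀ {p} → Prime p → ∀ m n → p ∤ m → p ∤ n → p ∤ m ℕ.* n
  prime∤* pr m n p∤m p∤n p∣mn = [ p∤m , p∤n ]′ (euclidsLemma m n pr p∣mn)

  abs-^ : ∀ y n → ∣ y ^ n ∣ ≡ ∣ y ∣ ℕ.^ n
  abs-^ y zero    = refl
  abs-^ y (suc n) = trans (abs-* y (y ^ n)) (cong (∣ y ∣ ℕ.*_) (abs-^ y n))

  -- The congruence pins the exponent of p in j N to suc e, and p ^ n divides
  -- y ^ n as soon as p does.
  exponent≤valuation : ∀ {p N n} {y : ℤ} → Prime p → + N ≡ y ^ n →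
    ∀ e j t → p ∤ j → p ∤ t →
    + j * + N ≈ + t * (+ p) ^ suc e [mod (+ p) ^ suc (suc e) ] → n ≤ suc e
  exponent≤valuation {p} {N} {n} {y} pr N≡ e j t p∤j p∤t (quot q eq) =
    ℕ.≮⇒≥ λ e<n → too-divisible (∣-trans (^-monoʳ-∣ p e<n) p^n∣N)
    where
    instance _ = prime⇒nonZero pr
    E = (+ p) ^ e
    alg₁ : ∀ p t E q → t * (p * E) + p * (p * E) * q ≡ (t * E + p * E * q) * p
    alg₁ = solve-∀
    alg₂ : ∀ p t E j s q → (j * (s * (p * (p * E))) - p * (p * E) * q) ≡ p * (p * E) * (j * s - q)
    alg₂ = solve-∀
    alg₃ : ∀ p t E q → (p * E) * t ≡ t * (p * E) + p * (p * E) * q - p * (p * E) * q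
    alg₃ = solve-∀
    alg₄ : ∀ p E r → p * (p * E) * r ≡ (p * E) * (r * p)
    alg₄ = solve-∀
    p∣j*N : p ∣ j ℕ.* N
    p∣j*N = ℤ∣.∣⇒∣ᵤ {+ p} {+ (j ℕ.* N)} (ℤ∣.divides (+ t * E + + p * E * q) (trans (pos-* j N) (trans eq (alg₁ (+ p) (+ t) E q))))
    |N|≡ : N ≡ ∣ y ∣ ℕ.^ n
    |N|≡ = trans (cong ∣_∣ N≡) (abs-^ y n)
    p∣y : p ∣ ∣ y ∣
    p∣y = prime∣^⇒prime∣ pr ∣ y ∣ n (subst (p ∣_) |N|≡
      ([ (λ p∣j → contradiction p∣j p∤j) , (λ p∣N → p∣N) ]′ (euclidsLemma j N pr p∣j*N)))
    p^n∣N : p ℕ.^ n ∣ N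
    p^n∣N = subst (p ℕ.^ n ∣_) (sym |N|≡) (^-monoˡ-∣ n p∣y)
    too-divisible : p ℕ.^ suc (suc e) ∤ N
    too-divisible (divides s N≡s) = p∤t (ℤ∣.∣⇒∣ᵤ {+ p} {+ t} (ℤ∣.divides (+ j * + s - q)
      (*-cancelˡ-≡ (+ (p ℕ.^ suc e)) (+ t) ((+ j * + s - q) * + p) {{ℕ.m^n≢0 p (suc e)}} (begin
        + (p ℕ.^ suc e) * + t
          ≡⟨ cong (_* + t) (pos-^ p (suc e)) ⟩
        (+ p * E) * + t
          ≡⟨ alg₃ (+ p) (+ t) E q ⟩
        + t * (+ p * E) + + p * (+ p * E) * q - + p * (+ p * E) * q
          ≡⟨ cong (_- + p * (+ p * E) * q) eq ⟨
        + j * + N - + p * (+ p * E) * q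
          ≡⟨ cong (λ m → + j * m - + p * (+ p * E) * q)
               (trans (cong +_ N≡s) (trans (pos-* s _) (cong (+ s *_) (pos-^ p (suc (suc e)))))) ⟩
        + j * (+ s * (+ p * (+ p * E))) - + p * (+ p * E) * q
          ≡⟨ alg₂ (+ p) (+ t) E (+ j) (+ s) q ⟩
        + p * (+ p * E) * (+ j * + s - q)
          ≡⟨ alg₄ (+ p) E (+ j * + s - q) ⟩
        + p * E * ((+ j * + s - q) * + p)
          ≡⟨ cong (_* ((+ j * + s - q) * + p)) (pos-^ p (suc e)) ⟨
        + (p ℕ.^ suc e) * ((+ j * + s - q) * + p) ∎))))
      where open ≡-Reasoning

  exponent≤valuation-≡ : ∀ {p N n} {y : ℤ} → Prime p → + N ≡ y ^ n →
    ∀ e j t → p ∤ j → p ∤ t → j ℕ.* N ≡ t ℕ.* p ℕ.^ suc e → n ≤ suc e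
  exponent≤valuation-≡ {p} {N} pr N≡ e j t p∤j p∤t eq = exponent≤valuation pr N≡ e j t p∤j p∤t
    (mod-refl (trans (sym (pos-* j N)) (trans (cong +_ eq)
      (trans (pos-* t (p ℕ.^ suc e)) (cong (+ t *_) (pos-^ p (suc e)))))))

  -- A known lower bound `d` is split off the valuation so that truncated subtractions such as
  -- `(2 + e) ∸ 1` compute to `suc e`, the positive form that `exponent≤valuation` expects.
  valuation-split : ∀ {p} → Prime p → ∀ d n .{{_ : ℕ.NonZero n}} → p ℕ.^ d ∣ n →
    ∃₂ λ e m → v p n ≡ d ℕ.+ e × n ≡ m ℕ.* p ℕ.^ (d ℕ.+ e) × p ∤ m
  valuation-split {p} pr d n p^d∣n with v-isLargest p n {{prime⇒nonTrivial pr}}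
  ... | divides m n≡ , largest = v p n ℕ.∸ d , m , sym v≡ ,
    subst (λ e → n ≡ m ℕ.* p ℕ.^ e) (sym v≡) n≡ ,
    λ { (divides-refl q) → ℕ.1+n≰n (largest (suc (v p n))
          (divides q (trans n≡ (ℕ.*-assoc q p (p ℕ.^ v p n))))) }
    where
    v≡ : d ℕ.+ (v p n ℕ.∸ d) ≡ v p n
    v≡ = ℕ.m+[n∸m]≡n (largest d p^d∣n)

  ^-distribʳ-* : ∀ u w k → (u * w) ^ k ≡ u ^ k * w ^ k
  ^-distribʳ-* u w zero    = refl
  ^-distribʳ-* u w (suc k) = trans (cong ((u * w) *_) (^-distribʳ-* u w k)) (alg u w (u ^ k) (w ^ k))
    where alg : ∀ u w U W → u * w * (U * W) ≡ u * U * (w * W)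
          alg = solve-∀

  ^-multiple : ∀ z p c k j → j ≤ c ℕ.* k → ∃ λ r → (z * p ^ c) ^ k ≡ r * p ^ j
  ^-multiple z p c k j j≤ = z ^ k * p ^ (c ℕ.* k ℕ.∸ j) , (begin
    (z * p ^ c) ^ k                           ≡⟨ ^-distribʳ-* z (p ^ c) k ⟩
    z ^ k * (p ^ c) ^ k                       ≡⟨ cong (z ^ k *_) (^-*-assoc p c k) ⟩
    z ^ k * p ^ (c ℕ.* k)                     ≡⟨ cong (λ i → z ^ k * p ^ i) (ℕ.m∸n+n≡m j≤) ⟨
    z ^ k * p ^ (c ℕ.* k ℕ.∸ j ℕ.+ j)         ≡⟨ cong (z ^ k *_) (^-distribˡ-+-* p (c ℕ.* k ℕ.∸ j) j) ⟩
    z ^ k * (p ^ (c ℕ.* k ℕ.∸ j) * p ^ j)     ≡⟨ *-assoc (z ^ k) _ _ ⟨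
    z ^ k * p ^ (c ℕ.* k ℕ.∸ j) * p ^ j       ∎)
    where open ≡-Reasoning

  -- Small exponents

  -- The start stays general because the recursion of `Sum` moves it; the range from `x + 1` is
  -- substituted only in the closed forms of `T`.
  P₁-closed : ∀ a n → + 2 * P 1 a n ≡ + n * (+ 2 * a + + n - 1ℤ)
  P₁-closed a zero    = sym (*-zeroˡ (+ 2 * a + 0ℤ - 1ℤ))
  P₁-closed a (suc n) = trans (*-distribˡ-+ (+ 2) (a ^ 1) (P 1 (1ℤ + a) n))
    (trans (cong (_+_ (+ 2 * a ^ 1)) (P₁-closed (1ℤ + a) n)) (alg a (+ n)))
    where alg : ∀ a n → + 2 * (a * 1ℤ) + n * (+ 2 * (1ℤ + a) + n - 1ℤ) ≡ (1ℤ + n) * (+ 2 * a + (1ℤ + n) - 1ℤ)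
          alg = solve-∀

  P₂-closed : ∀ a n → + 6 * P 2 a n ≡
    + 6 * + n * a * a + + 6 * a * + n * (+ n - 1ℤ) + + n * (+ n - 1ℤ) * (+ 2 * + n - 1ℤ)
  P₂-closed a zero    = alg a
    where alg : ∀ a → 0ℤ ≡ + 6 * 0ℤ * a * a + + 6 * a * 0ℤ * (0ℤ - 1ℤ) + 0ℤ * (0ℤ - 1ℤ) * (+ 2 * 0ℤ - 1ℤ)
          alg = solve-∀
  P₂-closed a (suc n) = trans (*-distribˡ-+ (+ 6) (a ^ 2) (P 2 (1ℤ + a) n))
    (trans (cong (_+_ (+ 6 * a ^ 2)) (P₂-closed (1ℤ + a) n)) (alg a (+ n)))
    where alg : ∀ a n → + 6 * (a * (a * 1ℤ))
                  + (+ 6 * n * (1ℤ + a) * (1ℤ + a) + + 6 * (1ℤ + a) * n * (n - 1ℤ) + n * (n - 1ℤ) * (+ 2 * n - 1ℤ))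
                ≡ + 6 * (1ℤ + n) * a * a + + 6 * a * (1ℤ + n) * ((1ℤ + n) - 1ℤ)
                  + (1ℤ + n) * ((1ℤ + n) - 1ℤ) * (+ 2 * (1ℤ + n) - 1ℤ)
          alg = solve-∀

  P₃-closed : ∀ a n → + 4 * P 3 a n ≡
    + 4 * + n * a * a * a + + 6 * a * a * + n * (+ n - 1ℤ)
    + + 2 * a * + n * (+ n - 1ℤ) * (+ 2 * + n - 1ℤ) + + n * + n * (+ n - 1ℤ) * (+ n - 1ℤ)
  P₃-closed a zero    = alg a
    where alg : ∀ a → 0ℤ ≡ + 4 * 0ℤ * a * a * a + + 6 * a * a * 0ℤ * (0ℤ - 1ℤ)
                  + + 2 * a * 0ℤ * (0ℤ - 1ℤ) * (+ 2 * 0ℤ - 1ℤ) + 0ℤ * 0ℤ * (0ℤ - 1ℤ) * (0ℤ - 1ℤ)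
          alg = solve-∀
  P₃-closed a (suc n) = trans (*-distribˡ-+ (+ 4) (a ^ 3) (P 3 (1ℤ + a) n))
    (trans (cong (_+_ (+ 4 * a ^ 3)) (P₃-closed (1ℤ + a) n)) (alg a (+ n)))
    where alg : ∀ a n → let b = 1ℤ + a; m = 1ℤ + n in
                + 4 * (a * (a * (a * 1ℤ)))
                + (+ 4 * n * b * b * b + + 6 * b * b * n * (n - 1ℤ)
                   + + 2 * b * n * (n - 1ℤ) * (+ 2 * n - 1ℤ) + n * n * (n - 1ℤ) * (n - 1ℤ))
                ≡ + 4 * m * a * a * a + + 6 * a * a * m * (m - 1ℤ)
                  + + 2 * a * m * (m - 1ℤ) * (+ 2 * m - 1ℤ) + m * m * (m - 1ℤ) * (m - 1ℤ)
          alg = solve-∀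

  T₁-closed : ∀ x → 2 ℕ.* T 1 x ≡ x ℕ.* (3 ℕ.* x ℕ.+ 1)
  T₁-closed x = +-injective (trans (pos-* 2 (T 1 x)) (trans (cong (+ 2 *_) (T≡P 1 x)) (trans (P₁-closed (+ suc x) x)
    (trans (alg (+ x)) (sym (trans (pos-* x _) (cong (λ u → + x * (u + 1ℤ)) (pos-* 3 x))))))))
    where alg : ∀ x → x * (+ 2 * (1ℤ + x) + x - 1ℤ) ≡ x * (+ 3 * x + 1ℤ)
          alg = solve-∀

  T₂-closed : ∀ x → 6 ℕ.* T 2 x ≡ x ℕ.* (2 ℕ.* x ℕ.+ 1) ℕ.* (7 ℕ.* x ℕ.+ 1)
  T₂-closed x = +-injective (trans (pos-* 6 (T 2 x)) (trans (cong (+ 6 *_) (T≡P 2 x)) (trans (P₂-closed (+ suc x) x)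
    (trans (alg (+ x)) (sym (trans (pos-* (x ℕ.* (2 ℕ.* x ℕ.+ 1)) _)
      (cong₂ _*_ (trans (pos-* x _) (cong (λ u → + x * (u + 1ℤ)) (pos-* 2 x))) (cong (_+ 1ℤ) (pos-* 7 x)))))))))
    where alg : ∀ x → + 6 * x * (1ℤ + x) * (1ℤ + x) + + 6 * (1ℤ + x) * x * (x - 1ℤ) + x * (x - 1ℤ) * (+ 2 * x - 1ℤ)
                    ≡ x * (+ 2 * x + 1ℤ) * (+ 7 * x + 1ℤ)
          alg = solve-∀

  T₃-closed : ∀ x → 4 ℕ.* T 3 x ≡ x ℕ.* x ℕ.* ((5 ℕ.* x ℕ.+ 3) ℕ.* (3 ℕ.* x ℕ.+ 1))
  T₃-closed x = +-injective (trans (pos-* 4 (T 3 x)) (trans (cong (+ 4 *_) (T≡P 3 x)) (trans (P₃-closed (+ suc x) x)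
    (trans (alg (+ x)) (sym (trans (pos-* (x ℕ.* x) _)
      (cong₂ _*_ (pos-* x x) (trans (pos-* (5 ℕ.* x ℕ.+ 3) _)
        (cong₂ (λ u w → (u + + 3) * (w + 1ℤ)) (pos-* 5 x) (pos-* 3 x))))))))))
    where alg : ∀ x → let a = 1ℤ + x in
                  + 4 * x * a * a * a + + 6 * a * a * x * (x - 1ℤ)
                  + + 2 * a * x * (x - 1ℤ) * (+ 2 * x - 1ℤ) + x * x * (x - 1ℤ) * (x - 1ℤ)
                ≡ x * x * ((+ 5 * x + + 3) * (+ 3 * x + 1ℤ))
          alg = solve-∀

  -- Powers of 2 and 3 in the sum over x + 1, …, 2x

  mod-halve : ∀ {a b m} → a + a ≈ + 2 * b [mod + 2 * m ] → a ≈ b [mod m ]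
  mod-halve {a} {b} {m} (quot q eq) = quot q
    (*-cancelˡ-≡ (+ 2) a (b + m * q) (trans (alg₁ a) (trans eq (alg₂ b m q))))
    where
    alg₁ : ∀ a → + 2 * a ≡ a + a
    alg₁ = solve-∀
    alg₂ : ∀ b m q → + 2 * b + + 2 * m * q ≡ + 2 * (b + m * q)
    alg₂ = solve-∀

  -- The range is one term longer than a multiple of `2 ^ suc c`. The extra term is `(2x) ^ k`,
  -- which vanishes modulo `2 ^ suc c` once `suc c` is at most `k`: the origin of the lower bounds
  -- on `k`.
  P-near-one-2^ : ∀ h m c x → x ≡ suc (m ℕ.* 2 ℕ.^ suc c) → suc c ≤ 2 ℕ.* suc h →
    P (2 ℕ.* suc h) (+ suc x) x ≈ + m * (+ 2) ^ c [mod (+ 2) ^ suc c ]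
  P-near-one-2^ h m c x@(suc n) refl c<k = quot (q + r) (begin
    P k (+ suc x) (suc n)
      ≡⟨ Sum-snoc (_^ k) (+ suc x) n ⟩
    P k (+ suc x) n + (+ n + + suc x) ^ k
      ≡⟨ cong₂ _+_ e (trans (cong (_^ k) (alg₁ (+ n))) r-eq) ⟩
    + m * (+ 2) ^ c + (+ 2) ^ suc c * q + r * (+ 2) ^ suc c
      ≡⟨ alg₂ (+ m * (+ 2) ^ c) ((+ 2) ^ suc c) q r ⟩
    + m * (+ 2) ^ c + (+ 2) ^ suc c * (q + r) ∎)
    where
    open ≡-Reasoning
    k = 2 ℕ.* suc h
    open _≈_[mod_] (even-P-multiple-2^ h (suc x) m c) renaming (quotient to q; equality to e)
    last-term : ∃ λ r → (+ x * (+ 2) ^ 1) ^ k ≡ r * (+ 2) ^ suc c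
    last-term = ^-multiple (+ x) (+ 2) 1 k (suc c) (subst (suc c ≤_) (sym (ℕ.*-identityˡ k)) c<k)
    r = proj₁ last-term
    r-eq = proj₂ last-term
    alg₁ : ∀ n → n + (1ℤ + (1ℤ + n)) ≡ (1ℤ + n) * + 2
    alg₁ = solve-∀
    alg₂ : ∀ a M q r → a + M * q + r * M ≡ a + M * (q + r)
    alg₂ = solve-∀

  -- Reflection in `3x + 1` would preserve the range x + 1, ..., 2x, but for `p` dividing `x` that
  -- centre is prime to `p`. The centre `3x` is divisible by `p`; it sends the range to x, ..., 2x -
  -- 1, and the mismatch is the pair of end terms, which `double-power` makes negligible.
  P-reflect-3x : ∀ {M} h x → let k = suc (2 ℕ.* h); s = + 3 * + x in
    (∀ w → (s + w) ^ k ≈ w ^ k + + k * s * w ^ (2 ℕ.* h) [mod M ]) →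
    P k (+ suc x) x + P k (+ suc x) x
      ≈ + k * s * P (2 ℕ.* h) (+ suc x) x + ((+ x + + x) ^ k - (+ x) ^ k) [mod M ]
  P-reflect-3x {M} h x expand = quot q (begin
    P′ + P′
      ≡⟨ alg₁ A P′ C ⟩
    A + P′ + (C + P′ - A - C)
      ≡⟨ cong₂ (λ u w → u + (w - A - C)) e (Sum-snoc (_^ k) (+ x) x) ⟩
    R + M * q + (A + D - A - C)
      ≡⟨ alg₂ A C D R (M * q) ⟩
    R + (D - C) + M * q ∎)
    where
    open ≡-Reasoning
    k = suc (2 ℕ.* h)
    s = + 3 * + x
    A = P k (+ x) x
    P′ = P k (+ suc x) x
    C = (+ x) ^ k
    D = (+ x + + x) ^ k
    R = + k * s * P (2 ℕ.* h) (+ suc x) x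
    alg₀ : ∀ x → 1ℤ + + 3 * x ≡ x + (1ℤ + x) + x
    alg₀ = solve-∀
    alg₁ : ∀ a p c → p + p ≡ a + p + (c + p - a - c)
    alg₁ = solve-∀
    alg₂ : ∀ a c d r m → r + m + (a + d - a - c) ≡ r + (d - c) + m
    alg₂ = solve-∀
    open _≈_[mod_] (odd-P-reflect h s (+ x) (+ suc x) x (alg₀ (+ x)) expand)
      renaming (quotient to q; equality to e)

  pos-power : ∀ m p c → + (m ℕ.* p ℕ.^ c) ≡ + m * (+ p) ^ c
  pos-power m p c = trans (pos-* m (p ℕ.^ c)) (cong (+ m *_) (pos-^ p c))

  double-power : ∀ m p c k j → j ≤ c ℕ.* k →
    let X = + m * (+ p) ^ c in ∃ λ r → (X + X) ^ k - X ^ k ≡ r * (+ p) ^ j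
  double-power m p c k j j≤ with ^-multiple (+ m) (+ p) c k j j≤ | ^-multiple (+ 2 * + m) (+ p) c k j j≤
  ... | r₁ , e₁ | r₂ , e₂ = r₂ - r₁ ,
    trans (cong₂ _-_ (trans (cong (_^ k) (alg₁ (+ m) ((+ p) ^ c))) e₂) e₁) (alg₂ r₂ r₁ ((+ p) ^ j))
    where
    alg₁ : ∀ m M → m * M + m * M ≡ + 2 * m * M
    alg₁ = solve-∀
    alg₂ : ∀ r s M → r * M - s * M ≡ (r - s) * M
    alg₂ = solve-∀

  -- For odd `m`, let `a = 2 + e` be the exponent of 2 in `x`. The main term `k * 3x` times the even
  -- sum has exponent `a + (a - 1)`, and halving leaves `2a - 2`. The error `9x ^ 2` has exponent
  -- `2a`, just enough.
  odd-P-multiple-2^ : ∀ h m e x → x ≡ m ℕ.* 2 ℕ.^ (2 ℕ.+ e) → let k = suc (2 ℕ.* suc h) in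
    P k (+ suc x) x ≈ + (3 ℕ.* k ℕ.* m ℕ.* m) * (+ 2) ^ suc (e ℕ.+ suc e) [mod (+ 2) ^ (2 ℕ.+ (e ℕ.+ suc e)) ]
  odd-P-multiple-2^ h m e x x≡ = mod-halve (quot (+ 3 * K * + m * q₁ + r + + 9 * + m * + m * q₂) (begin
    P′ + P′
      ≡⟨ e₂ ⟩
    K * (+ 3 * + x) * P (2 ℕ.* suc h) (+ suc x) x + ((+ x + + x) ^ k - (+ x) ^ k) + + 3 * + x * (+ 3 * + x) * q₂
      ≡⟨ cong₂ (λ X Q → K * (+ 3 * X) * Q + ((X + X) ^ k - X ^ k) + + 3 * X * (+ 3 * X) * q₂) X≡ Q≡ ⟩
    K * (+ 3 * (+ m * (+ 2 * M))) * (+ m * M + + 2 * M * q₁)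
      + ((+ m * (+ 2 * M) + + m * (+ 2 * M)) ^ k - (+ m * (+ 2 * M)) ^ k)
      + + 3 * (+ m * (+ 2 * M)) * (+ 3 * (+ m * (+ 2 * M))) * q₂
      ≡⟨ cong (λ z → K * (+ 3 * (+ m * (+ 2 * M))) * (+ m * M + + 2 * M * q₁) + z
                 + + 3 * (+ m * (+ 2 * M)) * (+ 3 * (+ m * (+ 2 * M))) * q₂)
           (trans r≡ (cong (λ z → r * (+ 2 * (+ 2 * z))) Z≡)) ⟩
    K * (+ 3 * (+ m * (+ 2 * M))) * (+ m * M + + 2 * M * q₁) + r * (+ 2 * (+ 2 * (M * M)))
      + + 3 * (+ m * (+ 2 * M)) * (+ 3 * (+ m * (+ 2 * M))) * q₂
      ≡⟨ alg K (+ m) M q₁ r q₂ ⟩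
    + 2 * (+ 3 * K * + m * + m * (M * M)) + + 2 * (+ 2 * (M * M)) * Y
      ≡⟨ cong₂ (λ t z → + 2 * (t * z) + + 2 * (+ 2 * z) * Y) t≡ Z≡ ⟨
    + 2 * (+ (3 ℕ.* k ℕ.* m ℕ.* m) * Z) + + 2 * (+ 2 * Z) * Y ∎))
    where
    open ≡-Reasoning
    k = suc (2 ℕ.* suc h)
    K = + k
    M = (+ 2) ^ suc e
    Z = (+ 2) ^ suc (e ℕ.+ suc e)
    P′ = P k (+ suc x) x
    open _≈_[mod_] (even-P-multiple-2^ h (suc x) m (suc e)) renaming (quotient to q₁; equality to e₁)
    open _≈_[mod_] (P-reflect-3x (suc h) x (expand₁ (2 ℕ.* suc h) (+ 3 * + x))) renaming (quotient to q₂; equality to e₂)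
    Z≡ : Z ≡ M * M
    Z≡ = ^-distribˡ-+-* (+ 2) (suc e) (suc e)
    X≡ : + x ≡ + m * (+ 2 * M)
    X≡ = trans (cong +_ x≡) (pos-power m 2 (2 ℕ.+ e))
    Q≡ : P (2 ℕ.* suc h) (+ suc x) x ≡ + m * M + + 2 * M * q₁
    Q≡ = trans (cong (P (2 ℕ.* suc h) (+ suc x)) x≡) e₁
    -- The end terms must vanish modulo twice the final modulus, `2 ^ (2e + 4)`; since `k` is at
    -- least 3 they contain `2 ^ (3e + 6)`.
    bound : 3 ℕ.+ (e ℕ.+ suc e) ≤ (2 ℕ.+ e) ℕ.* k
    bound = ℕ.≤-trans (subst (3 ℕ.+ (e ℕ.+ suc e) ≤_) (alg-ℕ e) (ℕ.m≤m+n _ (2 ℕ.+ e)))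
      (ℕ.*-monoʳ-≤ (2 ℕ.+ e) (s≤s (subst (2 ≤_) (sym (ℕ.*-suc 2 h)) (ℕ.m≤m+n 2 (2 ℕ.* h)))))
      where alg-ℕ : ∀ e → 3 ℕ.+ (e ℕ.+ suc e) ℕ.+ (2 ℕ.+ e) ≡ (2 ℕ.+ e) ℕ.* 3
            alg-ℕ = ℕR.solve-∀
    ends = double-power m 2 (2 ℕ.+ e) k (3 ℕ.+ (e ℕ.+ suc e)) bound
    r = proj₁ ends
    r≡ = proj₂ ends
    Y = + 3 * K * + m * q₁ + r + + 9 * + m * + m * q₂
    t≡ : + (3 ℕ.* k ℕ.* m ℕ.* m) ≡ + 3 * K * + m * + m
    t≡ = trans (pos-* (3 ℕ.* k ℕ.* m) m) (cong (_* + m) (trans (pos-* (3 ℕ.* k) m) (cong (_* + m) (pos-* 3 k))))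
    alg : ∀ K m M q₁ r q₂ →
      K * (+ 3 * (m * (+ 2 * M))) * (m * M + + 2 * M * q₁) + r * (+ 2 * (+ 2 * (M * M)))
        + + 3 * (m * (+ 2 * M)) * (+ 3 * (m * (+ 2 * M))) * q₂
      ≡ + 2 * (+ 3 * K * m * m * (M * M)) + + 2 * (+ 2 * (M * M)) * (+ 3 * K * m * q₁ + r + + 9 * m * m * q₂)
    alg = solve-∀

  odd-P-multiple-3^ : ∀ h b k′ m e x → x ≡ m ℕ.* 3 ℕ.^ suc e → let k = suc (2 ℕ.* suc h) in
    k ≡ 3 ℕ.^ b ℕ.* k′ → 3 ℕ.+ b ≤ k → 2 ≤ k →
    P k (+ suc x) x + P k (+ suc x) x
      ≈ + (2 ℕ.* k′ ℕ.* m ℕ.* m) * (+ 3) ^ (2 ℕ.+ (b ℕ.+ (e ℕ.+ e))) [mod (+ 3) ^ (3 ℕ.+ (b ℕ.+ (e ℕ.+ e))) ]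
  odd-P-multiple-3^ h b k′ m e x x≡ k≡ b≤k 2≤k = quot Y (begin
    P′ + P′
      ≡⟨ e₂ ⟩
    + k * (+ 3 * + x) * P (2 ℕ.* suc h) (+ suc x) x + ((+ x + + x) ^ k - (+ x) ^ k) + B * (+ 3 * + x * (+ 3 * + x)) * q₂
      ≡⟨ cong₂ (λ X Q → + k * (+ 3 * X) * Q + ((X + X) ^ k - X ^ k) + B * (+ 3 * X * (+ 3 * X)) * q₂) X≡ Q≡ ⟩
    + k * (+ 3 * X) * (+ 2 * + m * F + + 3 * F * q₁) + ((X + X) ^ k - X ^ k) + B * (+ 3 * X * (+ 3 * X)) * q₂
      ≡⟨ cong₂ (λ K z → K * (+ 3 * X) * (+ 2 * + m * F + + 3 * F * q₁) + z + B * (+ 3 * X * (+ 3 * X)) * q₂)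
           K≡ (trans r≡ (cong (λ z → r * (+ 3 * (+ 3 * (+ 3 * z)))) Z≡)) ⟩
    B * + k′ * (+ 3 * X) * (+ 2 * + m * F + + 3 * F * q₁) + r * (+ 3 * (+ 3 * (+ 3 * (B * (F * F)))))
      + B * (+ 3 * X * (+ 3 * X)) * q₂
      ≡⟨ alg B F (+ k′) (+ m) q₁ r q₂ ⟩
    + 2 * + k′ * + m * + m * (+ 3 * (+ 3 * (B * (F * F)))) + + 3 * (+ 3 * (+ 3 * (B * (F * F)))) * Y
      ≡⟨ cong₂ (λ t z → t * (+ 3 * (+ 3 * z)) + + 3 * (+ 3 * (+ 3 * z)) * Y) t≡ Z≡ ⟨
    + (2 ℕ.* k′ ℕ.* m ℕ.* m) * (+ 3 * (+ 3 * Z)) + + 3 * (+ 3 * (+ 3 * Z)) * Y ∎)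
    where
    open ≡-Reasoning
    k = suc (2 ℕ.* suc h)
    B = (+ 3) ^ b
    F = (+ 3) ^ e
    X = + m * (+ 3 * F)
    Z = (+ 3) ^ (b ℕ.+ (e ℕ.+ e))
    P′ = P k (+ suc x) x
    open _≈_[mod_] (even-P-multiple-3^ h (suc x) m e) renaming (quotient to q₁; equality to e₁)
    open _≈_[mod_] (P-reflect-3x (suc h) x (λ w → expand-3^ b k′ (2 ℕ.* suc h) (+ x) w k≡)) renaming (quotient to q₂; equality to e₂)
    Z≡ : Z ≡ B * (F * F)
    Z≡ = trans (^-distribˡ-+-* (+ 3) b (e ℕ.+ e)) (cong (B *_) (^-distribˡ-+-* (+ 3) e e))
    K≡ : + k ≡ B * + k′
    K≡ = trans (cong +_ k≡) (trans (pos-* (3 ℕ.^ b) k′) (cong (_* + k′) (pos-^ 3 b)))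
    X≡ : + x ≡ X
    X≡ = trans (cong +_ x≡) (pos-power m 3 (suc e))
    Q≡ : P (2 ℕ.* suc h) (+ suc x) x ≡ + 2 * + m * F + + 3 * F * q₁
    Q≡ = trans (cong (P (2 ℕ.* suc h) (+ suc x)) x≡)
      (trans e₁ (cong (λ z → z * F + + 3 * F * q₁) (pos-* 2 m)))
    bound : 3 ℕ.+ (b ℕ.+ (e ℕ.+ e)) ≤ suc e ℕ.* k
    bound = subst (_≤ suc e ℕ.* k) (alg-ℕ b e) (ℕ.+-mono-≤ b≤k (ℕ.*-monoʳ-≤ e 2≤k))
      where alg-ℕ : ∀ b e → 3 ℕ.+ b ℕ.+ e ℕ.* 2 ≡ 3 ℕ.+ (b ℕ.+ (e ℕ.+ e))
            alg-ℕ = ℕR.solve-∀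
    ends = double-power m 3 (suc e) k (3 ℕ.+ (b ℕ.+ (e ℕ.+ e))) bound
    r = proj₁ ends
    r≡ = proj₂ ends
    Y = + k′ * + m * q₁ + r + + 3 * + m * + m * q₂
    t≡ : + (2 ℕ.* k′ ℕ.* m ℕ.* m) ≡ + 2 * + k′ * + m * + m
    t≡ = trans (pos-* (2 ℕ.* k′ ℕ.* m) m) (cong (_* + m) (trans (pos-* (2 ℕ.* k′) m) (cong (_* + m) (pos-* 2 k′))))
    alg : ∀ B F k m q₁ r q₂ → let X = m * (+ 3 * F) in
      B * k * (+ 3 * X) * (+ 2 * m * F + + 3 * F * q₁) + r * (+ 3 * (+ 3 * (+ 3 * (B * (F * F)))))
        + B * (+ 3 * X * (+ 3 * X)) * q₂
      ≡ + 2 * k * m * m * (+ 3 * (+ 3 * (B * (F * F))))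
        + + 3 * (+ 3 * (+ 3 * (B * (F * F)))) * (k * m * q₁ + r + + 3 * m * m * q₂)
    alg = solve-∀

  reflect-3x+1 : ∀ x → 1ℤ + + (3 ℕ.* x ℕ.+ 1) ≡ + suc x + + suc x + + x
  reflect-3x+1 x = cong +_ (alg x)
    where alg : ∀ x → suc (3 ℕ.* x ℕ.+ 1) ≡ suc x ℕ.+ suc x ℕ.+ x
          alg = ℕR.solve-∀

  -- With 8 dividing `s = 3x + 1`, the error `s ^ 2` is fine enough at first order. The even sum is
  -- needed only modulo 4, where it is `2 * m`; for odd `m` its single factor 2 is the one removed
  -- by halving, so the exponent of `3x + 1` remains.
  odd-P-near-one : ∀ h m m′ e x → x ≡ suc (m ℕ.* 4) → 3 ℕ.* x ℕ.+ 1 ≡ m′ ℕ.* 2 ℕ.^ (3 ℕ.+ e) →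
    let k = suc (2 ℕ.* suc h) in
    P k (+ suc x) x ≈ + (k ℕ.* m′ ℕ.* m) * (+ 2) ^ (3 ℕ.+ e) [mod (+ 2) ^ (4 ℕ.+ e) ]
  odd-P-near-one h m m′ e x x≡ N≡ = mod-halve (quot (K * + m′ * q₁ + + 2 * + m′ * + m′ * F * q₂) (begin
    P′ + P′
      ≡⟨ e₂ ⟩
    K * N * P (2 ℕ.* suc h) (+ suc x) x + N * N * q₂
      ≡⟨ cong₂ (λ n Q → K * n * Q + n * n * q₂) (trans (cong +_ N≡) (pos-power m′ 2 (3 ℕ.+ e))) e₁ ⟩
    K * (+ m′ * (+ 2 * (+ 2 * (+ 2 * F)))) * (+ m * + 2 + + 4 * q₁)
      + + m′ * (+ 2 * (+ 2 * (+ 2 * F))) * (+ m′ * (+ 2 * (+ 2 * (+ 2 * F)))) * q₂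
      ≡⟨ alg K (+ m′) (+ m) F q₁ q₂ ⟩
    + 2 * (K * + m′ * + m * (+ 2 * (+ 2 * (+ 2 * F)))) + + 2 * (+ 2 * (+ 2 * (+ 2 * (+ 2 * F)))) * Y
      ≡⟨ cong (λ t → + 2 * (t * (+ 2 * (+ 2 * (+ 2 * F)))) + + 2 * (+ 2 * (+ 2 * (+ 2 * (+ 2 * F)))) * Y) t≡ ⟨
    + 2 * (+ (k ℕ.* m′ ℕ.* m) * (+ 2 * (+ 2 * (+ 2 * F)))) + + 2 * (+ 2 * (+ 2 * (+ 2 * (+ 2 * F)))) * Y ∎))
    where
    open ≡-Reasoning
    k = suc (2 ℕ.* suc h)
    K = + k
    F = (+ 2) ^ e
    N = + (3 ℕ.* x ℕ.+ 1)
    P′ = P k (+ suc x) x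
    open _≈_[mod_] (P-near-one-2^ h m 1 x x≡ (subst (2 ≤_) (sym (ℕ.*-suc 2 h)) (ℕ.m≤m+n 2 (2 ℕ.* h))))
      renaming (quotient to q₁; equality to e₁)
    open _≈_[mod_] (odd-P-reflect (suc h) N (+ suc x) (+ suc x) x (reflect-3x+1 x) (expand₁ (2 ℕ.* suc h) N))
      renaming (quotient to q₂; equality to e₂)
    Y = K * + m′ * q₁ + + 2 * + m′ * + m′ * F * q₂
    t≡ : + (k ℕ.* m′ ℕ.* m) ≡ K * + m′ * + m
    t≡ = trans (pos-* (k ℕ.* m′) m) (cong (_* + m) (pos-* k m′))
    alg : ∀ K m′ m F q₁ q₂ → let G = + 2 * (+ 2 * (+ 2 * F)) in
      K * (m′ * G) * (m * + 2 + + 4 * q₁) + m′ * G * (m′ * G) * q₂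
      ≡ + 2 * (K * m′ * m * G) + + 2 * (+ 2 * G) * (K * m′ * q₁ + + 2 * m′ * m′ * F * q₂)
    alg = solve-∀

  -- This controls the sum of exponent `k - 2` in the second-order term of the reflection. Exponent
  -- 1 must be left out: `x = 1` gives the sum 2. Hence the later use requires `k` at least 5.
  odd-P-near-one-mod-4 : ∀ h m N′ x → x ≡ suc (m ℕ.* 4) → 3 ℕ.* x ℕ.+ 1 ≡ N′ ℕ.* 4 →
    P (suc (2 ℕ.* suc h)) (+ suc x) x ≈ 0ℤ [mod + 4 ]
  odd-P-near-one-mod-4 h m N′ x x≡ N≡ = mod-halve (quot Y (begin
    P′ + P′
      ≡⟨ e₂ ⟩
    K * N * P (2 ℕ.* suc h) (+ suc x) x + N * N * q₂
      ≡⟨ cong₂ (λ n Q → K * n * Q + n * n * q₂) (trans (cong +_ N≡) (pos-* N′ 4)) e₁ ⟩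
    K * (+ N′ * + 4) * (+ m * + 2 + + 4 * q₁) + + N′ * + 4 * (+ N′ * + 4) * q₂
      ≡⟨ alg K (+ N′) (+ m) q₁ q₂ ⟩
    + 2 * 0ℤ + + 2 * + 4 * Y ∎))
    where
    open ≡-Reasoning
    k = suc (2 ℕ.* suc h)
    K = + k
    N = + (3 ℕ.* x ℕ.+ 1)
    P′ = P k (+ suc x) x
    open _≈_[mod_] (P-near-one-2^ h m 1 x x≡ (subst (2 ≤_) (sym (ℕ.*-suc 2 h)) (ℕ.m≤m+n 2 (2 ℕ.* h))))
      renaming (quotient to q₁; equality to e₁)
    open _≈_[mod_] (odd-P-reflect (suc h) N (+ suc x) (+ suc x) x (reflect-3x+1 x) (expand₁ (2 ℕ.* suc h) N))
      renaming (quotient to q₂; equality to e₂)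
    Y = K * + N′ * (+ m + + 2 * q₁) + + 2 * + N′ * + N′ * q₂
    alg : ∀ K N m q₁ q₂ →
      K * (N * + 4) * (m * + 2 + + 4 * q₁) + N * + 4 * (N * + 4) * q₂
      ≡ + 2 * 0ℤ + + 2 * + 4 * (K * N * (m + + 2 * q₁) + + 2 * N * N * q₂)
    alg = solve-∀

  -- The second-order term of the reflection is needed here because 3x + 1 is
  -- only divisible by 4; its cube 64 is what limits the exponent.
  odd-P-near-one-2^ : ∀ h m m₄ N′ c w x → x ≡ suc (m ℕ.* 2 ℕ.^ suc c) → x ≡ suc (m₄ ℕ.* 4) →
    3 ℕ.* x ℕ.+ 1 ≡ N′ ℕ.* 4 → + 8 ≡ (+ 2) ^ c * w →
    let k = 3 ℕ.+ 2 ℕ.* suc h in suc c ≤ 2 ℕ.+ 2 ℕ.* suc h →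
    P k (+ suc x) x ≈ + (k ℕ.* N′ ℕ.* m) * (+ 2) ^ suc c [mod (+ 2) ^ (2 ℕ.+ c) ]
  odd-P-near-one-2^ h m m₄ N′ c w x x≡ x≡₄ N≡ 8≡ c<k = mod-halve (quot Y (begin
    P′ + P′
      ≡⟨ e₃ ⟩
    K * N * P (2 ℕ.+ 2 ℕ.* suc h) (+ suc x) x + B * (N * N) * P (suc (2 ℕ.* suc h)) (+ suc x) x + N * N * N * q₃
      ≡⟨ cong₂ (λ Q R → K * N * Q + B * (N * N) * R + N * N * N * q₃) Q≡ e₂ ⟩
    K * N * (+ m * L + + 2 * L * q₁) + B * (N * N) * (0ℤ + + 4 * q₂) + N * N * N * q₃
      ≡⟨ cong (λ n → K * n * (+ m * L + + 2 * L * q₁) + B * (n * n) * (0ℤ + + 4 * q₂) + n * n * n * q₃)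
           (trans (cong +_ N≡) (pos-* N′ 4)) ⟩
    K * n * (+ m * L + + 2 * L * q₁) + B * (n * n) * (0ℤ + + 4 * q₂) + n * n * n * q₃
      -- Both error terms are multiples of 64: `n * n` gives 16 and the lower odd sum gives 4, and
      -- `n * n * n` gives 64. The modulus before halving is `8 * L`, so one factor 8 is matched
      -- directly and the other is written as `L * w`.
      ≡⟨ alg₁ K (+ N′) (+ m) L B q₁ q₂ q₃ ⟩
    K * n * (+ m * L + + 2 * L * q₁) + + 8 * S
      ≡⟨ cong (λ z → K * n * (+ m * L + + 2 * L * q₁) + z * S) 8≡ ⟩
    K * n * (+ m * L + + 2 * L * q₁) + L * w * S
      ≡⟨ alg₂ K (+ N′) (+ m) L w B q₁ q₂ q₃ ⟩
    + 2 * (K * + N′ * + m * (+ 2 * L)) + + 2 * (+ 2 * (+ 2 * L)) * Y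
      ≡⟨ cong (λ t → + 2 * (t * (+ 2 * L)) + + 2 * (+ 2 * (+ 2 * L)) * Y) t≡ ⟨
    + 2 * (+ (k ℕ.* N′ ℕ.* m) * (+ 2 * L)) + + 2 * (+ 2 * (+ 2 * L)) * Y ∎))
    where
    open ≡-Reasoning
    k = 3 ℕ.+ 2 ℕ.* suc h
    K = + k
    L = (+ 2) ^ c
    N = + (3 ℕ.* x ℕ.+ 1)
    n = + N′ * + 4
    P′ = P k (+ suc x) x
    k-1≡ : 2 ℕ.* suc (suc h) ≡ 2 ℕ.+ 2 ℕ.* suc h
    k-1≡ = ℕ.*-suc 2 (suc h)
    open _≈_[mod_] (P-near-one-2^ (suc h) m c x x≡ (subst (suc c ≤_) (sym k-1≡) c<k))
      renaming (quotient to q₁; equality to e₁)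
    Q≡ : P (2 ℕ.+ 2 ℕ.* suc h) (+ suc x) x ≡ + m * L + + 2 * L * q₁
    Q≡ = trans (cong (λ i → P i (+ suc x) x) (sym k-1≡)) e₁
    open _≈_[mod_] (odd-P-near-one-mod-4 h m₄ N′ x x≡₄ N≡) renaming (quotient to q₂; equality to e₂)
    second-order = odd-P-reflect₂ (suc h) N (+ suc x) (+ suc x) x (reflect-3x+1 x)
    B = proj₁ second-order
    open _≈_[mod_] (proj₂ second-order) renaming (quotient to q₃; equality to e₃)
    S = + 8 * (B * + N′ * + N′ * q₂ + + N′ * + N′ * + N′ * q₃)
    Y = K * + N′ * q₁ + w * (B * + N′ * + N′ * q₂ + + N′ * + N′ * + N′ * q₃)
    t≡ : + (k ℕ.* N′ ℕ.* m) ≡ K * + N′ * + m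
    t≡ = trans (pos-* (k ℕ.* N′) m) (cong (_* + m) (pos-* k N′))
    alg₁ : ∀ K N m L B q₁ q₂ q₃ → let n = N * + 4 in
      K * n * (m * L + + 2 * L * q₁) + B * (n * n) * (0ℤ + + 4 * q₂) + n * n * n * q₃
      ≡ K * n * (m * L + + 2 * L * q₁) + + 8 * (+ 8 * (B * N * N * q₂ + N * N * N * q₃))
    alg₁ = solve-∀
    alg₂ : ∀ K N m L w B q₁ q₂ q₃ → let Q = B * N * N * q₂ + N * N * N * q₃ in
      K * (N * + 4) * (m * L + + 2 * L * q₁) + L * w * (+ 8 * Q)
      ≡ + 2 * (K * N * m * (+ 2 * L)) + + 2 * (+ 2 * (+ 2 * L)) * (K * N * q₁ + w * Q)
    alg₂ = solve-∀

  -- Reflection in `2x + 1` carries x + 1, ..., 2x to 1, ..., x and preserves even powers modulo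
  -- `2x + 1`. Together with the zero term at 0, the two copies fill the range 0, ..., 2x, whose
  -- length is `2x + 1`.
  even-P-2x+1-multiple-3^ : ∀ h m e x → 2 ℕ.* x ℕ.+ 1 ≡ m ℕ.* 3 ℕ.^ suc e → let k = 2 ℕ.* suc h in
    P k (+ suc x) x + P k (+ suc x) x ≈ + (2 ℕ.* m) * (+ 3) ^ e [mod (+ 3) ^ suc e ]
  even-P-2x+1-multiple-3^ h m e x s≡ = mod-trans (mod-+ reflected (mod-refl {b = P k (+ suc x) x} refl))
    (mod-trans (mod-refl whole) (even-P-multiple-3^ h 0 m e))
    where
    k = 2 ℕ.* suc h
    s = + (2 ℕ.* x ℕ.+ 1)
    alg₀ : ∀ x → suc (2 ℕ.* x ℕ.+ 1) ≡ suc x ℕ.+ 1 ℕ.+ x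
    alg₀ = ℕR.solve-∀
    alg₁ : ∀ s u → s - u ≡ - u + s * 1ℤ
    alg₁ = solve-∀
    alg₂ : ∀ x → suc (x ℕ.+ x) ≡ 2 ℕ.* x ℕ.+ 1
    alg₂ = ℕR.solve-∀
    s′≡ : s ≡ (+ 3) ^ suc e * + m
    s′≡ = trans (cong +_ s≡) (trans (pos-power m 3 (suc e)) (*-comm (+ m) ((+ 3) ^ suc e)))
    reflected : P k (+ suc x) x ≈ P k 1ℤ x [mod (+ 3) ^ suc e ]
    reflected = mod-weaken (+ m) (subst (P k (+ suc x) x ≈ P k 1ℤ x [mod_]) s′≡
      (mod-trans (mod-refl (Sum-reflect (_^ k) s (+ suc x) 1ℤ x (cong +_ (alg₀ x))))
        (Sum-mod (λ u → mod-trans (mod-^ {b = - u} k (quot 1ℤ (alg₁ s u))) (mod-refl (neg-even-power (suc h) u))) 1ℤ x)))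
    whole : P k 1ℤ x + P k (+ suc x) x ≡ P k 0ℤ (m ℕ.* 3 ℕ.^ suc e)
    whole = begin
      P k 1ℤ x + P k (+ suc x) x    ≡⟨ cong (λ a → P k 1ℤ x + P k (+ a) x) (ℕ.+-comm 1 x) ⟩
      P k 1ℤ x + P k (+ x + 1ℤ) x   ≡⟨ Sum-++ (_^ k) 1ℤ x x ⟨
      P k 1ℤ (x ℕ.+ x)              ≡⟨ +-identityˡ (P k 1ℤ (x ℕ.+ x)) ⟨
      P k 0ℤ (suc (x ℕ.+ x))        ≡⟨ cong (P k 0ℤ) (trans (alg₂ x) s≡) ⟩
      P k 0ℤ (m ℕ.* 3 ℕ.^ suc e)    ∎
      where open ≡-Reasoning

  exponent≤-P : ∀ {p n} {y : ℤ} → Prime p → ∀ k x → + T k x ≡ y ^ n → ∀ e t → p ∤ t →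
    P k (+ suc x) x ≈ + t * (+ p) ^ suc e [mod (+ p) ^ suc (suc e) ] → n ≤ suc e
  exponent≤-P pr k x T≡ e t p∤t P≈ = exponent≤valuation pr T≡ e 1 t
    (λ p∣1 → ℕ.nonTrivial⇒≢1 {{prime⇒nonTrivial pr}} (∣1⇒≡1 p∣1)) p∤t
    (mod-trans (mod-refl (trans (*-identityˡ (+ T k x)) (T≡P k x))) P≈)

  exponent≤-2P : ∀ {p n} {y : ℤ} → Prime p → p ∤ 2 → ∀ k x → + T k x ≡ y ^ n → ∀ e t → p ∤ t →
    P k (+ suc x) x + P k (+ suc x) x ≈ + t * (+ p) ^ suc e [mod (+ p) ^ suc (suc e) ] → n ≤ suc e
  exponent≤-2P pr p∤2 k x T≡ e t p∤t P≈ = exponent≤valuation pr T≡ e 2 t p∤2 p∤t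
    (mod-trans (mod-refl (trans (cong (+ 2 *_) (T≡P k x)) (alg (P k (+ suc x) x)))) P≈)
    where alg : ∀ a → + 2 * a ≡ a + a
          alg = solve-∀

open import Data.Integer.Base using (ℤ; +_) renaming (_^_ to _^ℤ_)
import Data.Integer.Base as ℤ
open import Data.Nat.Base
open import Data.Nat.DivMod using (_/_; m≡m%n+[m/n]*n)
open import Data.Nat.Divisibility
open import Data.Nat.Primality using (Prime; prime[2]; prime⇒nonTrivial)
open import Data.Nat.Properties
open import Data.Nat.Tactic.RingSolver using (solve-∀)
open import Data.Product.Base using (∃; _×_; _,_; proj₂)
open import Data.Sum.Base using (_⊎_; inj₁; inj₂)
open import Defs
open import Relation.Binary.PropositionalEquality
open import Relation.Nullary using (contradiction)
open import Relation.Nullary.Decidable using (from-no)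
open PowerSums

-- Parities, residue forms and coprimality

∣⇒∤suc : ∀ {p m} → Prime p → p ∣ m → p ∤ suc m
∣⇒∤suc {p} {m} pr p∣m p∣1+m = nonTrivial⇒≢1 {{prime⇒nonTrivial pr}}
  (∣1⇒≡1 (∣m+n∣m⇒∣n (subst (p ∣_) (+-comm 1 m) p∣1+m) p∣m))

∣⇒∤+1 : ∀ {p m} → Prime p → p ∣ m → p ∤ m + 1
∣⇒∤+1 {p} {m} pr p∣m = subst (p ∤_) (+-comm 1 m) (∣⇒∤suc pr p∣m)

even⊎odd : ∀ k → (∃ λ h → k ≡ 2 * h) ⊎ (∃ λ h → k ≡ suc (2 * h))
even⊎odd zero    = inj₁ (0 , refl)
even⊎odd (suc k) with even⊎odd k
... | inj₁ (h , refl) = inj₂ (h , refl)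
... | inj₂ (h , refl) = inj₁ (suc h , sym (*-suc 2 h))

odd-form : ∀ {k} → 2 ∤ k → ∃ λ h → k ≡ suc (2 * h)
odd-form {k} 2∤k with even⊎odd k
... | inj₁ (h , refl) = contradiction (m∣m*n h) 2∤k
... | inj₂ k≡         = k≡

even-form : ∀ {k} → k ≥ 1 → 2 ∣ k → ∃ λ h → k ≡ 2 * suc h
even-form k≥1 (divides zero refl)    = contradiction k≥1 λ ()
even-form k≥1 (divides (suc h) refl) = h , *-comm (suc h) 2

odd-form-≥3 : ∀ {k} → k ≥ 3 → 2 ∤ k → ∃ λ h → k ≡ suc (2 * suc h)
odd-form-≥3 k≥3 2∤k with odd-form 2∤k
... | zero  , refl = contradiction k≥3 λ { (s≤s ()) }
... | suc h , k≡   = h , k≡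

odd-form-≥5 : ∀ {k} → k ≥ 5 → 2 ∤ k → ∃ λ h → k ≡ 3 + 2 * suc h
odd-form-≥5 k≥5 2∤k with odd-form-≥3 (≤-trans (s≤s (s≤s (s≤s z≤n))) k≥5) 2∤k
... | zero  , refl = contradiction k≥5 λ { (s≤s (s≤s (s≤s ()))) }
... | suc h , k≡   = h , trans k≡ (cong suc (*-suc 2 (suc h)))

residue-form : ∀ x d .{{_ : NonZero d}} {r} → x % d ≡ r → ∃ λ q → x ≡ r + q * d
residue-form x d x%d≡r = x / d , trans (m≡m%n+[m/n]*n x d) (cong (_+ x / d * d) x%d≡r)

2∤odd : ∀ h → 2 ∤ suc (2 * h)
2∤odd h = ∣⇒∤suc prime[2] (m∣m*n h)

2∤1 : 2 ∤ 1
2∤1 = ∣⇒∤suc prime[2] (2 ∣0)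

2∤3 : 2 ∤ 3
2∤3 = ∣⇒∤suc prime[2] ∣-refl

3∤2 : 3 ∤ 2
3∤2 = from-no (3 ∣? 2)

3∤4 : 3 ∤ 4
3∤4 = ∣⇒∤suc prime[3] ∣-refl

-- Bounds for exponents 1, 2 and 3 from the closed forms

T₁-bound-4∣x : ∀ {n} {y : ℤ} x .{{_ : NonZero x}} → + T 1 x ≡ y ^ℤ n → 4 ∣ x → n ≤ v 2 x ∸ 1
T₁-bound-4∣x {n} x T≡ 4∣x =
  let e , m , v≡ , x≡ , 2∤m = valuation-split prime[2] 2 x 4∣x in
  subst (λ w → n ≤ w ∸ 1) (sym v≡) (exponent≤valuation-≡ prime[2] T≡ e 1 (m * (3 * x + 1)) 2∤1
    (prime∤* prime[2] m (3 * x + 1) 2∤m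
      (∣⇒∤+1 prime[2] (∣n⇒∣m*n 3 (∣-trans (divides 2 refl) 4∣x))))
    (*-cancelˡ-≡ _ _ 2 (trans (cong (2 *_) (*-identityˡ (T 1 x))) (trans (T₁-closed x)
      (trans (cong (_* (3 * x + 1)) x≡) (alg m (2 ^ suc e) (3 * x + 1)))))))
  where alg : ∀ m E w → m * (2 * E) * w ≡ 2 * (m * w * E)
        alg = solve-∀

T₁-bound-x≡1[4] : ∀ {n} {y : ℤ} x → + T 1 x ≡ y ^ℤ n → x % 4 ≡ 1 → n ≤ v 2 (3 * x + 1) ∸ 1
T₁-bound-x≡1[4] {n} x T≡ x%4≡1 =
  let q , x≡1+4q = residue-form x 4 x%4≡1
      e , m , v≡ , N≡ , 2∤m = valuation-split prime[2] 2 (3 * x + 1) {{subst NonZero (+-comm 1 (3 * x)) _}}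
        (divides (3 * q + 1) (trans (cong (λ z → 3 * z + 1) x≡1+4q) (alg₁ q)))
  in
  subst (λ w → n ≤ w ∸ 1) (sym v≡) (exponent≤valuation-≡ prime[2] T≡ e 1 (x * m) 2∤1
    (prime∤* prime[2] x m
      (subst (2 ∤_) (sym x≡1+4q) (∣⇒∤suc prime[2] (∣n⇒∣m*n q (divides 2 refl)))) 2∤m)
    (*-cancelˡ-≡ _ _ 2 (trans (cong (2 *_) (*-identityˡ (T 1 x))) (trans (T₁-closed x)
      (trans (cong (x *_) N≡) (alg₂ x m (2 ^ suc e)))))))
  where
  alg₁ : ∀ q → 3 * (1 + q * 4) + 1 ≡ (3 * q + 1) * 4
  alg₁ = solve-∀
  alg₂ : ∀ x m E → x * (m * (2 * E)) ≡ 2 * (x * m * E)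
  alg₂ = solve-∀

T₂-bound-x≡1[8] : ∀ {n} {y : ℤ} x → + T 2 x ≡ y ^ℤ n → x % 8 ≡ 1 → n ≤ v 2 (7 * x + 1) ∸ 1
T₂-bound-x≡1[8] {n} x T≡ x%8≡1 =
  let q , x≡1+8q = residue-form x 8 x%8≡1
      e , m , v≡ , N≡ , 2∤m = valuation-split prime[2] 2 (7 * x + 1) {{subst NonZero (+-comm 1 (7 * x)) _}}
        (divides (14 * q + 2) (trans (cong (λ z → 7 * z + 1) x≡1+8q) (alg₁ q)))
  in
  subst (λ w → n ≤ w ∸ 1) (sym v≡) (exponent≤valuation-≡ prime[2] T≡ e 3 (x * (2 * x + 1) * m) 2∤3
    (prime∤* prime[2] (x * (2 * x + 1)) m
      (prime∤* prime[2] x (2 * x + 1)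
        (subst (2 ∤_) (sym x≡1+8q) (∣⇒∤suc prime[2] (∣n⇒∣m*n q (divides 4 refl))))
        (∣⇒∤+1 prime[2] (m∣m*n x))) 2∤m)
    (*-cancelˡ-≡ _ _ 2 (trans (sym (*-assoc 2 3 (T 2 x))) (trans (T₂-closed x)
      (trans (cong (x * (2 * x + 1) *_) N≡) (alg₂ (x * (2 * x + 1)) m (2 ^ suc e)))))))
  where
  alg₁ : ∀ q → 7 * (1 + q * 8) + 1 ≡ (14 * q + 2) * 4
  alg₁ = solve-∀
  alg₂ : ∀ x m E → x * (m * (2 * E)) ≡ 2 * (x * m * E)
  alg₂ = solve-∀

-- Here 8 divides `5x + 3`, so one factor 2 is left after the 4 of the closed form is cancelled.
T₃-bound-x≡1[8] : ∀ {n} {y : ℤ} x → + T 3 x ≡ y ^ℤ n → x % 8 ≡ 1 →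
  n ≤ v 2 ((5 * x + 3) * (3 * x + 1)) ∸ 2
T₃-bound-x≡1[8] {n} x T≡ x%8≡1 =
  let q , x≡1+8q = residue-form x 8 x%8≡1
      2∤x = subst (2 ∤_) (sym x≡1+8q) (∣⇒∤suc prime[2] (∣n⇒∣m*n q (divides 4 refl)))
      e , m , v≡ , N≡ , 2∤m = valuation-split prime[2] 3 ((5 * x + 3) * (3 * x + 1))
        {{subst₂ (λ a b → NonZero (a * b)) (+-comm 3 (5 * x)) (+-comm 1 (3 * x)) _}}
        (divides ((5 * q + 1) * (3 * x + 1))
          (trans (cong (λ z → (5 * z + 3) * (3 * x + 1)) x≡1+8q) (alg₁ q (3 * x + 1))))
  in
  subst (λ w → n ≤ w ∸ 2) (sym v≡) (exponent≤valuation-≡ prime[2] T≡ e 1 (x * x * m) 2∤1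
    (prime∤* prime[2] (x * x) m (prime∤* prime[2] x x 2∤x 2∤x) 2∤m)
    (*-cancelˡ-≡ _ _ 4 (trans (cong (4 *_) (*-identityˡ (T 3 x))) (trans (T₃-closed x)
      (trans (cong (x * x *_) N≡) (alg₂ (x * x) m (2 ^ suc e)))))))
  where
  alg₁ : ∀ q w → (5 * (1 + q * 8) + 3) * w ≡ (5 * q + 1) * w * 8
  alg₁ = solve-∀
  alg₂ : ∀ x m E → x * (m * (2 * (2 * E))) ≡ 4 * (x * m * E)
  alg₂ = solve-∀

T₁-bound-3∣x : ∀ {n} {y : ℤ} x .{{_ : NonZero x}} → + T 1 x ≡ y ^ℤ n → 3 ∣ x → n ≤ v 3 x
T₁-bound-3∣x {n} x T≡ 3∣x =
  let e , m , v≡ , x≡ , 3∤m = valuation-split prime[3] 1 x 3∣x in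
  subst (n ≤_) (sym v≡) (exponent≤valuation-≡ prime[3] T≡ e 2 (m * (3 * x + 1)) 3∤2
    (prime∤* prime[3] m (3 * x + 1) 3∤m (∣⇒∤+1 prime[3] (m∣m*n x)))
    (trans (T₁-closed x) (trans (cong (_* (3 * x + 1)) x≡) (alg m (3 ^ suc e) (3 * x + 1)))))
  where alg : ∀ m E w → m * E * w ≡ m * w * E
        alg = solve-∀

T₃-bound-3∣x : ∀ {n} {y : ℤ} x .{{_ : NonZero x}} → + T 3 x ≡ y ^ℤ n → 3 ∣ x →
  n ≤ v 3 (x ^ 2 * (5 * x + 3))
T₃-bound-3∣x {n} x@(suc _) T≡ 3∣x =
  let e , m , v≡ , N≡ , 3∤m = valuation-split prime[3] 1 (x ^ 2 * (5 * x + 3)) {{_}}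
        (∣m⇒∣m*n (5 * x + 3) (∣m⇒∣m*n (x * 1) 3∣x)) in
  subst (n ≤_) (sym v≡) (exponent≤valuation-≡ prime[3] T≡ e 4 (m * (3 * x + 1)) 3∤4
    (prime∤* prime[3] m (3 * x + 1) 3∤m (∣⇒∤+1 prime[3] (m∣m*n x)))
    (trans (T₃-closed x) (trans (alg₁ x) (trans (cong (_* (3 * x + 1)) N≡) (alg₂ m (3 ^ suc e) (3 * x + 1))))))
  where
  alg₁ : ∀ x → x * x * ((5 * x + 3) * (3 * x + 1)) ≡ x * (x * 1) * (5 * x + 3) * (3 * x + 1)
  alg₁ = solve-∀
  alg₂ : ∀ m E w → m * E * w ≡ m * w * E
  alg₂ = solve-∀

-- Bounds for general even and odd exponents

even-bound-4∣x : ∀ {n} {y : ℤ} h x .{{_ : NonZero x}} → + T (2 * suc h) x ≡ y ^ℤ n → 4 ∣ x →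
  n ≤ v 2 x ∸ 1
even-bound-4∣x {n} h x T≡ 4∣x =
  let e , m , v≡ , x≡ , 2∤m = valuation-split prime[2] 2 x 4∣x in
  subst (λ w → n ≤ w ∸ 1) (sym v≡) (exponent≤-P prime[2] (2 * suc h) x T≡ e m 2∤m
    (mod-trans (mod-refl (cong (P (2 * suc h) (+ suc x)) x≡)) (even-P-multiple-2^ h (suc x) m (suc e))))

odd-bound-4∣x : ∀ {n} {y : ℤ} h x .{{_ : NonZero x}} → + T (suc (2 * suc h)) x ≡ y ^ℤ n → 4 ∣ x →
  n ≤ 2 * v 2 x ∸ 2
odd-bound-4∣x {n} h x T≡ 4∣x =
  let e , m , v≡ , x≡ , 2∤m = valuation-split prime[2] 2 x 4∣x
      k = suc (2 * suc h)
  in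
  subst (λ w → n ≤ 2 * w ∸ 2) (sym v≡) (subst (n ≤_) (alg e)
    (exponent≤-P prime[2] k x T≡ (e + suc e) (3 * k * m * m)
      (prime∤* prime[2] (3 * k * m) m
        (prime∤* prime[2] (3 * k) m (prime∤* prime[2] 3 k 2∤3 (2∤odd (suc h))) 2∤m) 2∤m)
      (odd-P-multiple-2^ h m e x x≡)))
  where alg : ∀ e → suc (e + suc e) ≡ e + (2 + (e + 0))
        alg = solve-∀

odd-bound-x≡5[8] : ∀ {n} {y : ℤ} h x → + T (suc (2 * suc h)) x ≡ y ^ℤ n → x % 8 ≡ 5 →
  n ≤ v 2 (3 * x + 1)
odd-bound-x≡5[8] {n} h x T≡ x%8≡5 =
  let q , x≡5+8q = residue-form x 8 x%8≡5
      k = suc (2 * suc h)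
      m = suc (2 * q)
      e , m′ , v≡ , N≡ , 2∤m′ = valuation-split prime[2] 3 (3 * x + 1) {{subst NonZero (+-comm 1 (3 * x)) _}}
        (divides (3 * q + 2) (trans (cong (λ z → 3 * z + 1) x≡5+8q) (alg₁ q)))
  in
  subst (n ≤_) (sym v≡) (exponent≤-P prime[2] k x T≡ (2 + e) (k * m′ * m)
    (prime∤* prime[2] (k * m′) m (prime∤* prime[2] k m′ (2∤odd (suc h)) 2∤m′) (2∤odd q))
    (odd-P-near-one h m m′ e x (trans x≡5+8q (alg₂ q)) N≡))
  where
  alg₁ : ∀ q → 3 * (5 + q * 8) + 1 ≡ (3 * q + 2) * 8
  alg₁ = solve-∀
  alg₂ : ∀ q → 5 + q * 8 ≡ suc (suc (2 * q) * 4)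
  alg₂ = solve-∀

even-bound-near-one : ∀ {n} {y : ℤ} h q c x → + T (2 * suc h) x ≡ y ^ℤ n →
  x ≡ suc (suc (2 * q) * 2 ^ (2 + c)) → 2 + c ≤ 2 * suc h → n ≤ suc c
even-bound-near-one h q c x T≡ x≡ c<k =
  exponent≤-P prime[2] (2 * suc h) x T≡ c (suc (2 * q)) (2∤odd q) (P-near-one-2^ h (suc (2 * q)) (suc c) x x≡ c<k)

-- The exponent of 2 in `x - 1` is `a = 3 + c`. The even sum contributes `a - 1`, the factor
-- `3x + 1` contributes 2, and halving removes 1, which gives `a`. The equation for 8 restricts `c`
-- to 0 and 1.
odd-bound-near-one : ∀ {n} {y : ℤ} h q c w x → + T (3 + 2 * suc h) x ≡ y ^ℤ n →
  x ≡ suc (suc (2 * q) * 2 ^ (3 + c)) → + 8 ≡ (+ 2) ^ℤ (2 + c) ℤ.* w → 3 + c ≤ 2 + 2 * suc h → n ≤ 3 + c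
odd-bound-near-one h q c w x T≡ x≡ 8≡ c<k =
  exponent≤-P prime[2] k x T≡ (2 + c) (k * N′ * m)
    (prime∤* prime[2] (k * N′) m
      (prime∤* prime[2] k N′ (subst (2 ∤_) (cong suc (*-suc 2 (suc h))) (2∤odd (suc (suc h))))
        (∣⇒∤suc prime[2] (m∣m*n (3 * (m * 2 ^ c)))))
      (2∤odd q))
    (odd-P-near-one-2^ h m (m * 2 ^ suc c) N′ (2 + c) w x x≡
      (trans x≡ (cong suc (alg₁ m (2 ^ c)))) (trans (cong (λ z → 3 * z + 1) x≡) (alg₂ m (2 ^ c))) 8≡ c<k)
  where
  k = 3 + 2 * suc h
  m = suc (2 * q)
  -- The quotient of `3x + 1` by 4; it is odd because 8 divides `x - 1`.
  N′ = suc (2 * (3 * (m * 2 ^ c)))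
  alg₁ : ∀ m C → m * (2 * (2 * (2 * C))) ≡ m * (2 * C) * 4
  alg₁ = solve-∀
  alg₂ : ∀ m C → 3 * suc (m * (2 * (2 * (2 * C)))) + 1 ≡ suc (2 * (3 * (m * C))) * 4
  alg₂ = solve-∀

even-bound-9∣x : ∀ {n} {y : ℤ} h x .{{_ : NonZero x}} → + T (2 * suc h) x ≡ y ^ℤ n → 9 ∣ x →
  n ≤ v 3 x ∸ 1
even-bound-9∣x {n} h x T≡ 9∣x =
  let e , m , v≡ , x≡ , 3∤m = valuation-split prime[3] 2 x 9∣x in
  subst (λ w → n ≤ w ∸ 1) (sym v≡) (exponent≤-P prime[3] (2 * suc h) x T≡ e (2 * m)
    (prime∤* prime[3] 2 m 3∤2 3∤m)
    (mod-trans (mod-refl (cong (P (2 * suc h) (+ suc x)) x≡)) (even-P-multiple-3^ h (suc x) m (suc e))))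

even-bound-x≡4[9] : ∀ {n} {y : ℤ} h x → + T (2 * suc h) x ≡ y ^ℤ n → x % 9 ≡ 4 →
  n ≤ v 3 (2 * x + 1) ∸ 1
even-bound-x≡4[9] {n} h x T≡ x%9≡4 =
  let q , x≡4+9q = residue-form x 9 x%9≡4
      e , m , v≡ , N≡ , 3∤m = valuation-split prime[3] 2 (2 * x + 1) {{subst NonZero (+-comm 1 (2 * x)) _}}
        (divides (2 * q + 1) (trans (cong (λ z → 2 * z + 1) x≡4+9q) (alg q)))
  in
  subst (λ w → n ≤ w ∸ 1) (sym v≡) (exponent≤-2P prime[3] 3∤2 (2 * suc h) x T≡ e (2 * m)
    (prime∤* prime[3] 2 m 3∤2 3∤m) (even-P-2x+1-multiple-3^ h m (suc e) x N≡))
  where alg : ∀ q → 2 * (4 + q * 9) + 1 ≡ (2 * q + 1) * 9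
        alg = solve-∀

-- The shift by 2 is forced, as `3 + n ≤ 3 ^ n` fails for 0 and 1; for those two values
-- `valuation+3≤` falls back on `5 ≤ k`.
n+3≤3^n : ∀ n → 3 + (2 + n) ≤ 3 ^ (2 + n)
n+3≤3^n zero    = m≤m+n 5 4
n+3≤3^n (suc n) = ≤-trans (+-mono-≤ {1} (m^n>0 3 (2 + n)) (n+3≤3^n n)) (+-monoʳ-≤ (3 ^ (2 + n)) (m≤m+n _ _))

valuation+3≤ : ∀ b {k} → 5 ≤ k → 3 ^ b ≤ k → 3 + b ≤ k
valuation+3≤ zero          5≤k _    = ≤-trans (m≤m+n 3 2) 5≤k
valuation+3≤ (suc zero)    5≤k _    = ≤-trans (m≤m+n 4 1) 5≤k
valuation+3≤ (suc (suc b)) _   3^≤k = ≤-trans (n+3≤3^n b) 3^≤k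

odd-bound-3∣x : ∀ {n} {y : ℤ} h x .{{_ : NonZero x}} → let k = suc (2 * suc h) in
  5 ≤ k → + T k x ≡ y ^ℤ n → 3 ∣ x → n ≤ v 3 (k * x ^ 2)
odd-bound-3∣x {n} h x@(suc _) 5≤k T≡ 3∣x =
  let k = suc (2 * suc h)
      b , k′ , _ , k≡ , 3∤k′ = valuation-split prime[3] 0 k (1∣ k)
      e , m , _ , x≡ , 3∤m = valuation-split prime[3] 1 x 3∣x
      3^b≤k = ∣⇒≤ (divides k′ k≡)
  in
  ≤-trans
    (exponent≤-2P prime[3] 3∤2 k x T≡ (suc (b + (e + e))) (2 * k′ * m * m)
      (prime∤* prime[3] (2 * k′ * m) m (prime∤* prime[3] (2 * k′) m (prime∤* prime[3] 2 k′ 3∤2 3∤k′) 3∤m) 3∤m)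
      (odd-P-multiple-3^ h b k′ m e x x≡ (trans k≡ (*-comm k′ (3 ^ b)))
        (valuation+3≤ b 5≤k 3^b≤k) (≤-trans (m≤m+n 2 3) 5≤k)))
    (proj₂ (v-isLargest 3 (k * x ^ 2)) (2 + (b + (e + e)))
      (divides (k′ * m * m) (trans (cong₂ (λ k x → k * x ^ 2) k≡ x≡)
        (trans (alg k′ (3 ^ b) m (3 ^ e)) (cong (λ z → k′ * m * m * (3 * (3 * z)))
          (sym (trans (^-distribˡ-+-* 3 b (e + e)) (cong (3 ^ b *_) (^-distribˡ-+-* 3 e e)))))))))
  where
  alg : ∀ k B m F → k * B * (m * (3 * F) * (m * (3 * F) * 1)) ≡ k * m * m * (3 * (3 * (B * (F * F))))
  alg = solve-∀

-- Residue classes modulo 8, 16 and 32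

x≡5[8]-form : ∀ x → x % 8 ≡ 5 → ∃ λ q → x ≡ suc (suc (2 * q) * 2 ^ 2)
x≡5[8]-form x x%8≡5 = let q , x≡ = residue-form x 8 x%8≡5 in q , trans x≡ (alg q)
  where alg : ∀ q → 5 + q * 8 ≡ suc (suc (2 * q) * 4)
        alg = solve-∀

x≡9[16]-form : ∀ x → x % 16 ≡ 9 → ∃ λ q → x ≡ suc (suc (2 * q) * 2 ^ 3)
x≡9[16]-form x x%16≡9 = let q , x≡ = residue-form x 16 x%16≡9 in q , trans x≡ (alg q)
  where alg : ∀ q → 9 + q * 16 ≡ suc (suc (2 * q) * 8)
        alg = solve-∀

x≡17[32]-form : ∀ x → x % 32 ≡ 17 → ∃ λ q → x ≡ suc (suc (2 * q) * 2 ^ 4)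
x≡17[32]-form x x%32≡17 = let q , x≡ = residue-form x 32 x%32≡17 in q , trans x≡ (alg q)
  where alg : ∀ q → 17 + q * 32 ≡ suc (suc (2 * q) * 16)
        alg = solve-∀

even-bound-x≡5[8] : ∀ {n k} {y : ℤ} x → + T k x ≡ y ^ℤ n → x % 8 ≡ 5 → k ≥ 2 → 2 ∣ k → n ≤ 1
even-bound-x≡5[8] x T≡ x%8≡5 k≥2 2∣k
  with h , refl ← even-form (≤-trans (m≤m+n 1 1) k≥2) 2∣k =
  let q , x≡ = x≡5[8]-form x x%8≡5 in even-bound-near-one h q 0 x T≡ x≡ k≥2

even-bound-x≡9[16] : ∀ {n k} {y : ℤ} x → + T k x ≡ y ^ℤ n → x % 16 ≡ 9 → k ≥ 4 → 2 ∣ k → n ≤ 2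
even-bound-x≡9[16] x T≡ x%16≡9 k≥4 2∣k
  with h , refl ← even-form (≤-trans (m≤m+n 1 3) k≥4) 2∣k =
  let q , x≡ = x≡9[16]-form x x%16≡9 in
  even-bound-near-one h q 1 x T≡ x≡ (≤-trans (m≤m+n 3 1) k≥4)

even-bound-x≡17[32] : ∀ {n k} {y : ℤ} x → + T k x ≡ y ^ℤ n → x % 32 ≡ 17 → k ≥ 4 → 2 ∣ k → n ≤ 3
even-bound-x≡17[32] x T≡ x%32≡17 k≥4 2∣k
  with h , refl ← even-form (≤-trans (m≤m+n 1 3) k≥4) 2∣k =
  let q , x≡ = x≡17[32]-form x x%32≡17 in even-bound-near-one h q 2 x T≡ x≡ k≥4

odd-bound-x≡9[16] : ∀ {n k} {y : ℤ} x → + T k x ≡ y ^ℤ n → x % 16 ≡ 9 → k ≥ 5 → 2 ∤ k → n ≤ 3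
odd-bound-x≡9[16] x T≡ x%16≡9 k≥5 2∤k with h , refl ← odd-form-≥5 k≥5 2∤k =
  let q , x≡ = x≡9[16]-form x x%16≡9 in
  odd-bound-near-one h q 0 (+ 2) x T≡ x≡ refl (≤-trans (m≤m+n 3 1) (s≤s⁻¹ k≥5))

odd-bound-x≡17[32] : ∀ {n k} {y : ℤ} x → + T k x ≡ y ^ℤ n → x % 32 ≡ 17 → k ≥ 5 → 2 ∤ k → n ≤ 4
odd-bound-x≡17[32] x T≡ x%32≡17 k≥5 2∤k with h , refl ← odd-form-≥5 k≥5 2∤k =
  let q , x≡ = x≡17[32]-form x x%32≡17 in
  -- Here `2 ^ (2 + c)` is 8 itself, so `w` is 1 and the error 64 is just fine enough; the end term
  -- likewise needs exactly `4 ≤ k - 1`.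
  odd-bound-near-one h q 1 (+ 1) x T≡ x≡ refl (s≤s⁻¹ k≥5)

theorem2p1 : (x k n : ℕ) (y : ℤ) →
    x ≥ 1 → k ≥ 1 → n ≥ 2 →
    + (T k x) ≡ y ^ℤ n →
    -- (i)
    ( x % 4 ≡ 0 →
        (k ≡ 1 ⊎ 2 ∣ k → n ≤ v 2 x ∸ 1)
      × (k ≥ 3 → 2 ∤ k → n ≤ 2 * v 2 x ∸ 2) )
    ×
    -- (ii)
    ( x % 4 ≡ 1 → k ≡ 1 → n ≤ v 2 (3 * x + 1) ∸ 1 )
    ×
    ( x % 8 ≡ 1 ⊎ x % 8 ≡ 5 → x % 32 ≢ 1 → k ≢ 1 →
        (x % 8 ≡ 1 → k ≡ 2 → n ≤ v 2 (7 * x + 1) ∸ 1)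
      × (x % 8 ≡ 1 → k ≡ 3 → n ≤ v 2 ((5 * x + 3) * (3 * x + 1)) ∸ 2)
      × (x % 8 ≡ 5 → k ≥ 3 → 2 ∤ k → n ≤ v 2 (3 * x + 1))
      × (x % 8 ≡ 5 → k ≥ 2 → 2 ∣ k → n ≤ 1)
      × (x % 16 ≡ 9 → k ≥ 4 → 2 ∣ k → n ≤ 2)
      × ((x % 16 ≡ 9 × k ≥ 5 × 2 ∤ k) ⊎ (x % 32 ≡ 17 × k ≥ 4 × 2 ∣ k) → n ≤ 3)
      × (x % 32 ≡ 17 → k ≥ 5 → 2 ∤ k → n ≤ 4) )
    ×
    -- (iii)
    ( (x % 3 ≡ 0 × 2 ∤ k) ⊎ ((x % 9 ≡ 0 ⊎ x % 9 ≡ 4) × k ≥ 2 × 2 ∣ k) →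
        (x % 3 ≡ 0 → k ≡ 1 → n ≤ v 3 x)
      × (x % 9 ≡ 0 → k ≥ 2 → 2 ∣ k → n ≤ v 3 x ∸ 1)
      × (x % 3 ≡ 0 → k > 3 → 2 ∤ k → n ≤ v 3 (k * x ^ 2))
      × (x % 3 ≡ 0 → k ≡ 3 → n ≤ v 3 (x ^ 2 * (5 * x + 3)))
      × (x % 9 ≡ 4 → k ≥ 2 → 2 ∣ k → n ≤ v 3 (2 * x + 1) ∸ 1) )
theorem2p1 x@(suc _) k n y _ k≥1 _ T≡ =
    (λ x%4≡0 → let 4∣x = m%n≡0⇒n∣m x 4 x%4≡0 in
        (λ { (inj₁ refl) → T₁-bound-4∣x x T≡ 4∣x
           ; (inj₂ 2∣k)  → case-even k≥1 2∣k λ { h refl → even-bound-4∣x h x T≡ 4∣x } })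
      , λ k≥3 2∤k → case-odd k≥3 2∤k λ { h refl → odd-bound-4∣x h x T≡ 4∣x })
  , (λ { x%4≡1 refl → T₁-bound-x≡1[4] x T≡ x%4≡1 })
  , (λ _ _ _ →
        (λ { x%8≡1 refl → T₂-bound-x≡1[8] x T≡ x%8≡1 })
      , (λ { x%8≡1 refl → T₃-bound-x≡1[8] x T≡ x%8≡1 })
      , (λ x%8≡5 k≥3 2∤k → case-odd k≥3 2∤k λ { h refl → odd-bound-x≡5[8] h x T≡ x%8≡5 })
      , even-bound-x≡5[8] x T≡
      , even-bound-x≡9[16] x T≡
      , (λ { (inj₁ (x%16≡9 , k≥5 , 2∤k))  → odd-bound-x≡9[16] x T≡ x%16≡9 k≥5 2∤k
           ; (inj₂ (x%32≡17 , k≥4 , 2∣k)) → even-bound-x≡17[32] x T≡ x%32≡17 k≥4 2∣k })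
      , odd-bound-x≡17[32] x T≡)
  , λ _ →
        (λ { x%3≡0 refl → T₁-bound-3∣x x T≡ (m%n≡0⇒n∣m x 3 x%3≡0) })
      , (λ x%9≡0 _ 2∣k → case-even k≥1 2∣k λ { h refl → even-bound-9∣x h x T≡ (m%n≡0⇒n∣m x 9 x%9≡0) })
      , (λ x%3≡0 k>3 2∤k → odd-bound x%3≡0 k>3 2∤k)
      , (λ { x%3≡0 refl → T₃-bound-3∣x x T≡ (m%n≡0⇒n∣m x 3 x%3≡0) })
      , λ x%9≡4 _ 2∣k → case-even k≥1 2∣k λ { h refl → even-bound-x≡4[9] h x T≡ x%9≡4 }
  where
  case-even : ∀ {A : Set} → k ≥ 1 → 2 ∣ k → (∀ h → k ≡ 2 * suc h → A) → A
  case-even k≥1 2∣k f = let h , k≡ = even-form k≥1 2∣k in f h k≡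
  case-odd : ∀ {A : Set} → k ≥ 3 → 2 ∤ k → (∀ h → k ≡ suc (2 * suc h) → A) → A
  case-odd k≥3 2∤k f = let h , k≡ = odd-form-≥3 k≥3 2∤k in f h k≡
  odd-bound : x % 3 ≡ 0 → k > 3 → 2 ∤ k → n ≤ v 3 (k * x ^ 2)
  odd-bound x%3≡0 k>3 2∤k = case-odd (<⇒≤ k>3) 2∤k λ
    -- Oddness excludes 4, which raises `k > 3` to `5 ≤ k`.
    { h refl → odd-bound-3∣x h x (≤∧≢⇒< k>3 λ { 4≡k → 2∤k (subst (2 ∣_) 4≡k (divides 2 refl)) })
        T≡ (m%n≡0⇒n∣m x 3 x%3≡0) }
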